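{- Let $n$ be sufficiently large. In the $(1:1)$ WMaker--WBreaker Hamilton cycle game on $E(K_n)$ (with WBreaker making the first move), WMaker has a strategy to win in at most $n+6$ moves, i.e. to ensure that after at most $n+6$ of her own moves her claimed edges contain a Hamilton cycle of $K_n$.
   Context: The $(1:1)$ WMaker--WBreaker game on $E(K_n)$: two players, WMaker and WBreaker, alternately claim one edge of the complete graph $K_n$ per turn. Both players are walkers: at her/his first move a player chooses any vertex as starting position; when a player is positioned at a vertex $v$, she/he may only claim an edge incident with $v$ that has not previously been claimed by the opponent, and the other endpoint of the claimed edge becomes her/his new position. Unless stated otherwise WBreaker starts, so a round consists of a move of WBreaker followed by a move of WMaker. In the Hamilton cycle game WMaker wins once her claimed edges contain the edge set of a Hamilton cycle of $K_n$. -}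

module Defs where

open import Data.Nat using (ℕ; zero; suc; _∸_)
open import Data.Fin using (Fin; toℕ)
open import Data.Maybe using (Maybe; just; nothing)
open import Data.List using (List; []; _∷_)
open import Data.List.Membership.Propositional using (_∈_)
open import Data.Product using (_×_; _,_; ∃; ∃-syntax)
open import Data.Sum using (_⊎_)
open import Data.Empty using (⊥)
open import Relation.Nullary using (¬_)
open import Relation.Binary.PropositionalEquality using (_≡_; _≢_)
open import Function.Definitions using (Injective)

-- A list of claimed (directed) moves; the set of claimed edges of K_n is
-- the set of unordered pairs {u,v} with (u,v) or (v,u) in the list.
Edges : ℕ → Set
Edges n = List (Fin n × Fin n)

Claimed : ∀ {n} → Edges n → Fin n → Fin n → Set
Claimed E u v = (u , v) ∈ E ⊎ (v , u) ∈ E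

-- A walker at position pos (nothing = has not moved yet, may start anywhere)
-- may claim the edge uv of K_n (u ≠ v), moving from u to v, provided
-- u is its current position and uv has not been claimed by the opponent.
Legal : ∀ {n} → Maybe (Fin n) → Edges n → Fin n → Fin n → Set
Legal pos opp u v = (u ≢ v) × (pos ≡ nothing ⊎ pos ≡ just u) × ¬ Claimed opp u v

HasHamiltonCycle : ∀ {n} → Edges n → Set
HasHamiltonCycle {n} E =
  ∃[ f ] Injective {A = Fin n} {B = Fin n} _≡_ _≡_ f
    × (∀ i j → toℕ j ≡ suc (toℕ i) → Claimed E (f i) (f j))
    × (∀ i j → toℕ i ≡ n ∸ 1 → toℕ j ≡ 0 → Claimed E (f i) (f j))

record State (n : ℕ) : Set where
  constructor state
  field
    makerEdges   : Edges n
    breakerEdges : Edges n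
    makerPos     : Maybe (Fin n)
    breakerPos   : Maybe (Fin n)
open State public

BLegal : ∀ {n} → State n → Fin n → Fin n → Set
BLegal s u v = Legal (breakerPos s) (makerEdges s) u v

MLegal : ∀ {n} → State n → Fin n → Fin n → Set
MLegal s u v = Legal (makerPos s) (breakerEdges s) u v

breakerMove : ∀ {n} → State n → Fin n → Fin n → State n
breakerMove (state M B pm pb) u v = state M ((u , v) ∷ B) pm (just v)

makerMove : ∀ {n} → State n → Fin n → Fin n → State n
makerMove (state M B pm pb) u v = state ((u , v) ∷ M) B (just v) pb

initial : ∀ {n} → State n
initial = state [] [] nothing nothing

-- WMakerWinsWithin k s : in state s, with WBreaker to move, WMaker has a
-- strategy guaranteeing that after at most k further moves of her own her
-- claimed edges contain a Hamilton cycle.  If WBreaker has no legal move he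
-- passes (and WMaker must still win); if WMaker has no legal move she loses.
mutual
  WMakerWinsWithin : ∀ {n} → ℕ → State n → Set
  WMakerWinsWithin zero s = ⊥
  WMakerWinsWithin (suc k) s =
    (∀ u v → BLegal s u v → WMakerReply k (breakerMove s u v))
    × ((∀ u v → ¬ BLegal s u v) → WMakerReply k s)

  -- WMaker to move, with k further moves remaining after this one.
  WMakerReply : ∀ {n} → ℕ → State n → Set
  WMakerReply k s =
    ∃[ u ] ∃[ v ] MLegal s u v
      × (HasHamiltonCycle (makerEdges (makerMove s u v))
         ⊎ WMakerWinsWithin k (makerMove s u v))

{-# OPTIONS --safe #-}
-- WMaker extends a path from v to her position x by one new vertex per move.
-- Of WBreaker's edges none lies inside the set U of unvisited vertices, none
-- joins U to v, and those from x to U have at most one endpoint p (Free); or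
-- else none joins x to U, one vertex c of U may be joined to v, and WBreaker
-- is outside U or at c (Threat).  WMaker can always restore one of the two,
-- and can moreover steer to any given vertex of U within ten moves (Hunt).
-- With 993 vertices left she uses this to visit the at most 99 vertices of
-- WBreaker-degree above n/50, so every vertex left over has small degree.
--
-- From |U| = 3 she closes a cycle that misses one or two vertices, wasting no
-- move: if WBreaker blocks the closing edge at w₁ he is then at w₁, and cannot
-- block it at the next vertex w₂.  A missing vertex u is inserted by a chord to
-- a place z of the cycle where z and its two neighbours are not joined to u,
-- followed by zu and by one of the edges from u to these neighbours.  For the
-- last vertex a second chord may be needed.  In the worst case this wastes six
-- moves: a step back from v to a vertex of small degree, three chords, and one
-- move for each of two insertions.
module Submission where

open import Defs
open import Data.Nat
  using (ℕ; zero; suc; _+_; _*_; _∸_; _/_; _%_; _≤_; _<_; _<?_; z≤n; s≤s)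
open import Data.Nat.Properties
  using ( ≤-refl; ≤-trans; ≤-reflexive; ≤-pred; <⇒≤; n≤1+n; m≤n⇒m≤1+n
        ; ≮⇒≥; m≤m+n; m≤n+m; +-monoˡ-≤; +-monoʳ-≤; +-mono-≤; +-monoˡ-<; *-cancelˡ-≤; +-comm; +-assoc
        ; +-suc; *-monoˡ-≤; *-monoʳ-≤; *-monoʳ-<; *-comm; *-assoc; *-cancelʳ-<; +-cancelˡ-≤; +-cancelʳ-≤; suc-injective
        ; m∸n+n≡m; ≤ᵇ⇒≤; module ≤-Reasoning )
open import Data.Nat.DivMod using (m/n*n≤m; m≡m%n+[m/n]*n; m%n<n)
open import Data.Nat.Tactic.RingSolver using (solve-∀)
open import Data.Fin using (Fin; zero; suc; toℕ; cast)
open import Data.Fin.Properties using (_≟_; toℕ-cast; toℕ-injective)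
open import Data.Maybe using (just; nothing)
open import Data.Maybe.Properties using (just-injective)
open import Data.List using (List; []; _∷_; _++_; length; filter; map; lookup; allFin)
open import Data.Nat.ListAction using (sum)
open import Data.List.Properties using (++-identityʳ; length-++; length-tabulate; ++-assoc)
open import Data.List.Membership.Propositional using (_∈_; _∉_)
open import Data.List.Membership.Propositional.Properties
  using (∈-∃++; ∈-lookup; ∈-++⁺ˡ; ∈-++⁺ʳ; ∈-filter⁺; ∈-filter⁻; ∈-allFin)
import Data.List.Membership.DecPropositional as DecMembership
open import Data.List.Relation.Unary.Any using (here; there)
open import Data.List.Relation.Unary.All as All using (All; []; _∷_)
open import Data.List.Relation.Unary.AllPairs using ([]; _∷_)
open import Data.List.Relation.Unary.Unique.Propositional using (Unique)
open import Data.List.Relation.Unary.Unique.Propositional.Properties using (allFin⁺; filter⁺)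
open import Data.List.Relation.Binary.Permutation.Propositional
  using (_↭_; ↭-refl; ↭-sym; ↭-trans; ↭-reflexive; prep; swap; ↭⇒↭ₛ)
open import Data.List.Relation.Binary.Permutation.Propositional.Properties
  using (∈-resp-↭; ↭-length; shift; ++-comm; ++⁺ʳ; ++⁺ˡ)
import Data.List.Relation.Binary.Permutation.Setoid.Properties as SetoidPermutation
open import Data.Product using (_×_; _,_; proj₁; proj₂; ∃-syntax)
open import Data.Product.Properties using (≡-dec)
open import Data.Sum using (_⊎_; inj₁; inj₂; [_,_]′)
open import Data.Empty using ( ⊥-elim)
open import Function using (_∘_; id; case_of_)
open import Relation.Nullary using (¬_; Dec; yes; no; contradiction)
open import Relation.Nullary.Decidable using (_⊎-dec_; _×-dec_; ¬?)
open import Relation.Binary.PropositionalEquality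
  using (_≡_; _≢_; refl; sym; trans; cong; subst; ≢-sym; setoid)

-- Permutations, pigeonhole, and good triples in a list.

unique-resp-↭ : ∀ {A : Set} {xs ys : List A} → xs ↭ ys → Unique xs → Unique ys
unique-resp-↭ p = SetoidPermutation.Unique-resp-↭ (setoid _) (↭⇒↭ₛ p)

extract : ∀ {A : Set} {x : A} {xs} → x ∈ xs → ∃[ ys ] xs ↭ x ∷ ys
extract x∈ with ys , zs , refl ← ∈-∃++ x∈ = ys ++ zs , shift _ ys zs

module _ {n : ℕ} where

  open DecMembership (_≟_ {n}) using (_∈?_)

  private
    V = Fin n

  -- Induction on `us`: an entry found in `es` is discarded from both lists, and uniqueness keeps it
  -- from reappearing later in `us`.
  avoiding : ∀ (es us : List V) → Unique us → length es < length us →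
             ∃[ u ] u ∈ us × u ∉ es
  avoiding es [] _ ()
  avoiding es (u ∷ us) (u≢ ∷ uus) lt with u ∈? es
  ... | no u∉ = u , here refl , u∉
  ... | yes u∈ with es′ , p ← extract u∈
    with y , y∈ , y∉ ← avoiding es′ us uus
                         (≤-pred (subst (_< suc (length us)) (↭-length p) lt)) =
    y , there y∈ , λ y∈es → case ∈-resp-↭ p y∈es of λ where
      (here refl)  → All.lookup u≢ y∈ refl
      (there y∈es′) → y∉ y∈es′

  GoodTriple : (bad cs : List V) → Set
  GoodTriple bad cs = ∃[ as ] ∃[ a ] ∃[ z ] ∃[ e ] ∃[ bs ]
    cs ≡ as ++ a ∷ z ∷ e ∷ bs × a ∉ bad × z ∉ bad × e ∉ bad

  -- A spoilt triple uses up the bad vertex `h`. As `h` does not recur in `cs`, it can be struck off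
  -- `bad`, and both sides of the length bound drop by three.
  skipTriple : ∀ {bad cs a z e h} → 3 * suc (length bad) ≤ 3 + length cs →
               (∀ bad′ → 3 * suc (length bad′) ≤ length cs → GoodTriple bad′ cs) →
               h ∈ bad → (∀ {c} → c ∈ cs → h ≢ c) → GoodTriple bad (a ∷ z ∷ e ∷ cs)
  skipTriple {bad} {cs} {a} {z} {e} len rec h∈ h≢ with extract h∈
  ... | bad′ , p with rec bad′ (+-cancelˡ-≤ 3 _ _ (subst (_≤ 3 + length cs) (lengths (length bad′)) len′))
    where
    len′ : 3 * suc (suc (length bad′)) ≤ 3 + length cs
    len′ = subst (λ l → 3 * suc l ≤ 3 + length cs) (↭-length p) len
    lengths : ∀ l → 3 * suc (suc l) ≡ 3 + 3 * suc l
    lengths = solve-∀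
  ... | as , a′ , z′ , e′ , bs , refl , a∉ , z∉ , e∉ =
    a ∷ z ∷ e ∷ as , a′ , z′ , e′ , bs , refl
    , keep (∈-++⁺ʳ as (here refl)) a∉
    , keep (∈-++⁺ʳ as (there (here refl))) z∉
    , keep (∈-++⁺ʳ as (there (there (here refl)))) e∉
    where
    keep : ∀ {c} → c ∈ cs → c ∉ bad′ → c ∉ bad
    keep c∈ c∉ c∈bad with ∈-resp-↭ p c∈bad
    ... | here refl = h≢ c∈ refl
    ... | there c∈′ = c∉ c∈′

  -- Cut the list into consecutive triples: each bad vertex spoils at most one.
  goodTriple : ∀ (bad cs : List V) → Unique cs → 3 * suc (length bad) ≤ length cs →
               GoodTriple bad cs
  goodTriple bad [] _ ()
  goodTriple bad (_ ∷ []) _ len with s≤s () ← ≤-trans (*-monoʳ-≤ 3 (s≤s {n = length bad} z≤n)) len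
  goodTriple bad (_ ∷ _ ∷ []) _ len with s≤s (s≤s ()) ← ≤-trans (*-monoʳ-≤ 3 (s≤s {n = length bad} z≤n)) len
  goodTriple bad (a ∷ z ∷ e ∷ cs) (a≢ ∷ z≢ ∷ e≢ ∷ ucs) len
    with a ∈? bad | z ∈? bad | e ∈? bad
  ... | no a∉ | no z∉ | no e∉ = [] , a , z , e , cs , refl , a∉ , z∉ , e∉
  ... | yes h∈ | _ | _ = skipTriple len (λ bad′ → goodTriple bad′ cs ucs) h∈
                           (λ c∈ → All.lookup a≢ (there (there c∈)))
  ... | no _ | yes h∈ | _ = skipTriple len (λ bad′ → goodTriple bad′ cs ucs) h∈
                           (λ c∈ → All.lookup z≢ (there c∈))
  ... | no _ | no _ | yes h∈ = skipTriple len (λ bad′ → goodTriple bad′ cs ucs) h∈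
                           (λ c∈ → All.lookup e≢ c∈)

  -- Claimed edges, degrees and the handshake inequality.

  claimed? : ∀ (E : Edges n) u w → Dec (Claimed E u w)
  claimed? E u w = ((u , w) ∈ₑ? E) ⊎-dec ((w , u) ∈ₑ? E)
    where open DecMembership (≡-dec (_≟_ {n}) (_≟_ {n})) renaming (_∈?_ to _∈ₑ?_)

  claimed-sym : ∀ {E : Edges n} {u w} → Claimed E u w → Claimed E w u
  claimed-sym (inj₁ e) = inj₂ e
  claimed-sym (inj₂ e) = inj₁ e

  claimed-∷ : ∀ {E : Edges n} {e u w} → Claimed E u w → Claimed (e ∷ E) u w
  claimed-∷ (inj₁ e) = inj₁ (there e)
  claimed-∷ (inj₂ e) = inj₂ (there e)

  neighbours : Edges n → V → List V
  neighbours []            w = []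
  neighbours ((a , c) ∷ E) w with a ≟ w | c ≟ w
  ... | yes _ | _     = c ∷ neighbours E w
  ... | no _  | yes _ = a ∷ neighbours E w
  ... | no _  | no _  = neighbours E w

  -- Edges claimed several times are counted with multiplicity.
  degree : Edges n → V → ℕ
  degree E w = length (neighbours E w)

  claimed⇒neighbour : ∀ E {u w} → Claimed E w u → u ∈ neighbours E w
  claimed⇒neighbour [] (inj₁ ())
  claimed⇒neighbour [] (inj₂ ())
  claimed⇒neighbour ((a , c) ∷ E) {u} {w} cl with a ≟ w | c ≟ w | cl
  ... | yes _    | _       | inj₁ (here refl) = here refl
  ... | yes refl | _       | inj₂ (here refl) = here refl
  ... | yes _    | _       | inj₁ (there e)   = there (claimed⇒neighbour E (inj₁ e))
  ... | yes _    | _       | inj₂ (there e)   = there (claimed⇒neighbour E (inj₂ e))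
  ... | no a≢w   | _       | inj₁ (here refl) = contradiction refl a≢w
  ... | no _     | yes _   | inj₂ (here refl) = here refl
  ... | no _     | yes _   | inj₁ (there e)   = there (claimed⇒neighbour E (inj₁ e))
  ... | no _     | yes _   | inj₂ (there e)   = there (claimed⇒neighbour E (inj₂ e))
  ... | no _     | no c≢w  | inj₂ (here refl) = contradiction refl c≢w
  ... | no _     | no _    | inj₁ (there e)   = claimed⇒neighbour E (inj₁ e)
  ... | no _     | no _    | inj₂ (there e)   = claimed⇒neighbour E (inj₂ e)

  degree-∷ : ∀ e E w → degree (e ∷ E) w ≤ suc (degree E w)
  degree-∷ (a , c) E w with a ≟ w | c ≟ w
  ... | yes _ | _     = ≤-refl
  ... | no _  | yes _ = ≤-refl
  ... | no _  | no _  = n≤1+n _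

  indicator : V → V → ℕ
  indicator a w with a ≟ w
  ... | yes _ = 1
  ... | no _  = 0

  indicator-sum : ∀ a {ws} → Unique ws → sum (map (indicator a) ws) ≤ 1
  indicator-sum a {[]} _ = z≤n
  indicator-sum a {w ∷ ws} (w≢ ∷ uws) with a ≟ w
  ... | no _     = indicator-sum a uws
  ... | yes refl = s≤s (≤-reflexive (absent w≢))
    where
    absent : ∀ {vs} → All (a ≢_) vs → sum (map (indicator a) vs) ≡ 0
    absent [] = refl
    absent {v ∷ vs} (a≢v ∷ rest) with a ≟ v
    ... | yes a≡v = contradiction a≡v a≢v
    ... | no _    = absent rest

  degree-indicator : ∀ a c E w →
    degree ((a , c) ∷ E) w ≤ indicator a w + indicator c w + degree E w
  degree-indicator a c E w with a ≟ w | c ≟ w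
  ... | yes _ | yes _ = s≤s (n≤1+n _)
  ... | yes _ | no _  = ≤-refl
  ... | no _  | yes _ = ≤-refl
  ... | no _  | no _  = ≤-refl

  sum-map-+ : ∀ (f g h k : V → ℕ) → (∀ w → f w ≤ g w + h w + k w) → ∀ ws →
    sum (map f ws) ≤ sum (map g ws) + sum (map h ws) + sum (map k ws)
  sum-map-+ f g h k le [] = z≤n
  sum-map-+ f g h k le (w ∷ ws) =
    ≤-trans (+-mono-≤ (le w) (sum-map-+ f g h k le ws))
      (≤-reflexive (rearrange (g w) (h w) (k w) (sum (map g ws)) (sum (map h ws)) (sum (map k ws))))
    where
    rearrange : ∀ a b c a′ b′ c′ → (a + b + c) + (a′ + b′ + c′) ≡ (a + a′) + (b + b′) + (c + c′)
    rearrange = solve-∀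

  -- Each claimed edge adds at most one at each of its two ends, since `ws` has no repetitions; ends
  -- outside `ws` make this an inequality.
  handshake : ∀ E {ws} → Unique ws → sum (map (degree E) ws) ≤ 2 * length E
  handshake [] {ws} _ = ≤-reflexive (zeros ws)
    where
    zeros : ∀ vs → sum (map (degree []) vs) ≡ 0
    zeros []       = refl
    zeros (_ ∷ vs) = zeros vs
  handshake ((a , c) ∷ E) {ws} uws = begin
    sum (map (degree ((a , c) ∷ E)) ws)
      ≤⟨ sum-map-+ _ (indicator a) (indicator c) (degree E) (degree-indicator a c E) ws ⟩
    sum (map (indicator a) ws) + sum (map (indicator c) ws) + sum (map (degree E) ws)
      ≤⟨ +-mono-≤ (+-mono-≤ (indicator-sum a uws) (indicator-sum c uws)) (handshake E uws) ⟩
    2 + 2 * length E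
      ≡⟨ double (length E) ⟩
    2 * suc (length E) ∎
    where
    open ≤-Reasoning
    double : ∀ l → 2 + 2 * l ≡ 2 * suc l
    double = solve-∀

  heavy : ℕ → Edges n → List V → List V
  heavy H E = filter (λ w → H <? degree E w)

  -- The heavy vertices alone contribute at least `suc H` each to the degree sum, which the
  -- handshake inequality bounds.
  heavy-few : ∀ H E {ws} → Unique ws → length (heavy H E ws) * suc H ≤ 2 * length E
  heavy-few H E {ws} uws = ≤-trans (bound (heavy H E ws) λ w∈ → proj₂ (∈-filter⁻ (λ w → H <? degree E w) {xs = ws} w∈))
                             (handshake E (filter⁺ (λ w → H <? degree E w) uws))
    where
    bound : ∀ vs → (∀ {w} → w ∈ vs → H < degree E w) → length vs * suc H ≤ sum (map (degree E) vs)
    bound []       _  = z≤n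
    bound (v ∷ vs) lt = +-mono-≤ (lt (here refl)) (bound vs (lt ∘ there))

-- Moves of the two walkers and winning strategies.

module _ {n : ℕ} where

  open DecMembership (_≟_ {n}) using (_∈?_)

  private
    V = Fin n
    E = Edges n

  -- BreakerMove M B b g B′: WBreaker, at b with edges B against WMaker's M,
  -- ends at g with edges B′.  A pass leaves him at b.
  data BreakerMove (M B : E) (b : V) : V → E → Set where
    claims : ∀ {g} → b ≢ g → ¬ Claimed M b g → BreakerMove M B b g ((b , g) ∷ B)
    passes : BreakerMove M B b b B

  Joins : (b g u w : V) → Set
  Joins b g u w = b ≢ g × ((u ≡ b × w ≡ g) ⊎ (u ≡ g × w ≡ b))

  Extends : E → V → V → E → Set
  Extends B b g B′ = ∀ {u w} → Claimed B′ u w → Claimed B u w ⊎ Joins b g u w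

  extends : ∀ {M B b g B′} → BreakerMove M B b g B′ → Extends B b g B′
  extends (claims b≢g _) (inj₁ (here refl)) = inj₂ (b≢g , inj₁ (refl , refl))
  extends (claims b≢g _) (inj₂ (here refl)) = inj₂ (b≢g , inj₂ (refl , refl))
  extends (claims _ _)   (inj₁ (there e))   = inj₁ (inj₁ e)
  extends (claims _ _)   (inj₂ (there e))   = inj₁ (inj₂ e)
  extends passes         c                  = inj₁ c

  -- WBreaker can never add an edge that WMaker owns, so she can always step back along her last
  -- edge.
  keepsOff : ∀ {M B b g B′} → BreakerMove M B b g B′ → ∀ {u w} →
             Claimed M u w → ¬ Claimed B u w → ¬ Claimed B′ u w
  keepsOff (claims _ m∌) m b∌ (inj₁ (here refl)) = m∌ m
  keepsOff (claims _ m∌) m b∌ (inj₂ (here refl)) = m∌ (claimed-sym m)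
  keepsOff (claims _ _)  m b∌ (inj₁ (there e))   = b∌ (inj₁ e)
  keepsOff (claims _ _)  m b∌ (inj₂ (there e))   = b∌ (inj₂ e)
  keepsOff passes        m b∌ c                  = b∌ c

  degree-grows : ∀ {M B b g B′} → BreakerMove M B b g B′ → ∀ w → degree B′ w ≤ suc (degree B w)
  degree-grows {B = B} {b} {g} (claims _ _) w = degree-∷ (b , g) B w
  degree-grows passes       w = n≤1+n _

  length-grows : ∀ {M B b g B′} → BreakerMove M B b g B′ → length B′ ≤ suc (length B)
  length-grows (claims _ _) = ≤-refl
  length-grows passes       = n≤1+n _

  -- The winning predicates as records, so that unification does not unfold
  -- them: WBreaker, at b, is to move in Wins; WMaker, at x, in Replies.
  record Wins (k : ℕ) (M B : E) (x b : V) : Set where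
    constructor wins
    field unwins : WMakerWinsWithin k (state M B (just x) (just b))

  record Replies (k : ℕ) (M B : E) (x b : V) : Set where
    constructor replies
    field unreplies : WMakerReply k (state M B (just x) (just b))

  open Wins public
  open Replies public

  -- A strategy that answers a pass at any time covers the case in which WBreaker is stuck, so a
  -- pass is treated as one more kind of move.
  breakerTurn : ∀ {k M B x b} →
    (∀ {g B′} → BreakerMove M B b g B′ → Replies k M B′ x g) → Wins (suc k) M B x b
  breakerTurn {k} {M} {B} {x} {b} reply = wins
    ((λ u v → λ where
      (u≢v , inj₁ () , _)
      (u≢v , inj₂ at-u , m∌) → move (just-injective at-u) u≢v m∌)
    , λ _ → unreplies (reply passes))
    where
    move : ∀ {u v} → b ≡ u → u ≢ v → ¬ Claimed M u v →
           WMakerReply k (breakerMove (state M B (just x) (just b)) u v)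
    move refl u≢v m∌ = unreplies (reply (claims u≢v m∌))

  makerStep : ∀ {k M B x g y} → x ≢ y → ¬ Claimed B x y →
    HasHamiltonCycle ((x , y) ∷ M) ⊎ Wins k ((x , y) ∷ M) B y g → Replies k M B x g
  makerStep x≢y b∌ (inj₁ ham)      = replies (_ , _ , (x≢y , inj₂ refl , b∌) , inj₁ ham)
  makerStep x≢y b∌ (inj₂ (wins w)) = replies (_ , _ , (x≢y , inj₂ refl , b∌) , inj₂ w)

  mutual
    within-mono : ∀ {k l} {s : State n} → k ≤ l → WMakerWinsWithin k s → WMakerWinsWithin l s
    within-mono (s≤s k≤l) (move , pass) =
      (λ u v legal → reply-mono k≤l (move u v legal)) , (λ stuck → reply-mono k≤l (pass stuck))

    reply-mono : ∀ {k l} {s : State n} → k ≤ l → WMakerReply k s → WMakerReply l s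
    reply-mono k≤l (u , v , legal , inj₁ ham) = u , v , legal , inj₁ ham
    reply-mono k≤l (u , v , legal , inj₂ win) = u , v , legal , inj₂ (within-mono k≤l win)

  wins-mono : ∀ {k l M B x b} → k ≤ l → Wins k M B x b → Wins l M B x b
  wins-mono k≤l (wins w) = wins (within-mono k≤l w)

  -- Positions that WMaker maintains.

  -- WMaker's walk so far is a path from v to her position x, and U lists the
  -- vertices off that path.  WBreaker is at b.

  Independent : E → List V → Set
  Independent B U = ∀ {u w} → u ∈ U → w ∈ U → ¬ Claimed B u w

  -- With `p` outside `U` the last field says that no edge joins `x` to `U`, so one condition covers
  -- both no exceptional endpoint and one.
  record Free (B : E) (x v p : V) (U : List V) : Set where
    constructor free
    field
      inner : Independent B U
      first : ∀ {u} → u ∈ U → ¬ Claimed B v u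
      front : ∀ {u} → u ∈ U → Claimed B x u → u ≡ p

  record Threat (B : E) (x v c b : V) (U : List V) : Set where
    constructor threat
    field
      c∈U   : c ∈ U
      inner : Independent B U
      first : ∀ {u} → u ∈ U → u ≢ c → ¬ Claimed B v u
      front : ∀ {u} → u ∈ U → ¬ Claimed B x u
      home  : b ∈ U → b ≡ c

  data Sound (B : E) (x v b : V) (U : List V) : Set where
    is-free   : ∀ {p} → Free B x v p U → Sound B x v b U
    is-threat : ∀ {c} → Threat B x v c b U → Sound B x v b U

  record Frame (x v : V) (U : List V) : Set where
    field
      unique : Unique U
      x∉U    : x ∉ U
      v∉U    : v ∉ U
      x≢v    : x ≢ v

  record Removed (U : List V) (y : V) (U′ : List V) : Set where
    field
      sub  : ∀ {u} → u ∈ U′ → u ∈ U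
      gone : y ∉ U′
      back : ∀ {u} → u ∈ U → u ≢ y → u ∈ U′

  removed : ∀ {U y U′} → Unique U → U ↭ y ∷ U′ → Removed U y U′
  removed uU p = record
    { sub  = λ u∈ → ∈-resp-↭ (↭-sym p) (there u∈)
    ; gone = λ y∈ → case unique-resp-↭ p uU of λ where (y≢ ∷ _) → All.lookup y≢ y∈ refl
    ; back = λ u∈ u≢y → case ∈-resp-↭ p u∈ of λ where
        (here u≡y) → contradiction u≡y u≢y
        (there u∈′) → u∈′
    }

  -- Edges at WMaker's old position `x` count as harmless: they can hinder her next step, but not
  -- the position after it.
  data Place (v b g : V) (U : List V) : Set where
    inside   : b ∈ U → g ∈ U → b ≢ g → Place v b g U
    at-first : ∀ {u} → u ∈ U → g ≡ v ⊎ g ≡ u →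
               (∀ {s t} → Joins b g s t → (s ≡ v × t ≡ u) ⊎ (s ≡ u × t ≡ v)) → Place v b g U
    harmless : (∀ {s t} → s ∈ U → t ∈ U → ¬ Joins b g s t) →
               (∀ {t} → t ∈ U → ¬ Joins b g v t) → Place v b g U

  joins-self : ∀ {b u w} → ¬ Joins b b u w
  joins-self (b≢b , _) = b≢b refl

  place : ∀ v b g U → v ∉ U → Place v b g U
  place v b g U v∉U with b ≟ g
  ... | yes refl = harmless (λ _ _ → joins-self) (λ _ → joins-self)
  ... | no b≢g with b ∈? U | g ∈? U
  ... | yes b∈ | yes g∈ = inside b∈ g∈ b≢g
  ... | no b∉ | no g∉ = harmless
    (λ { s∈ _ (_ , inj₁ (refl , _)) → b∉ s∈ ; s∈ _ (_ , inj₂ (refl , _)) → g∉ s∈ })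
    (λ { t∈ (_ , inj₁ (_ , refl)) → g∉ t∈ ; t∈ (_ , inj₂ (_ , refl)) → b∉ t∈ })
  ... | yes b∈ | no g∉ with g ≟ v
  ...   | yes refl = at-first b∈ (inj₁ refl) λ { (_ , inj₁ e) → inj₂ e ; (_ , inj₂ e) → inj₁ e }
  ...   | no g≢v   = harmless
    (λ { _ t∈ (_ , inj₁ (_ , refl)) → g∉ t∈ ; s∈ _ (_ , inj₂ (refl , _)) → g∉ s∈ })
    (λ { t∈ (_ , inj₁ (_ , refl)) → g∉ t∈ ; _ (_ , inj₂ (refl , _)) → g≢v refl })
  place v b g U v∉U | no b≢g | no b∉ | yes g∈ with b ≟ v
  ...   | yes refl = at-first g∈ (inj₂ refl) λ { (_ , inj₁ e) → inj₁ e ; (_ , inj₂ e) → inj₂ e }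
  ...   | no b≢v   = harmless
    (λ { s∈ _ (_ , inj₁ (refl , _)) → b∉ s∈ ; _ t∈ (_ , inj₂ (_ , refl)) → b∉ t∈ })
    (λ { _ (_ , inj₁ (refl , _)) → b≢v refl ; t∈ (_ , inj₂ (_ , refl)) → b∉ t∈ })

  joins-left : ∀ {b g s t : V} → Joins b g s t → s ≡ b ⊎ s ≡ g
  joins-left (_ , inj₁ (s≡b , _)) = inj₁ s≡b
  joins-left (_ , inj₂ (s≡g , _)) = inj₂ s≡g

  joins-right : ∀ {b g s t : V} → Joins b g s t → t ≡ b ⊎ t ≡ g
  joins-right (_ , inj₁ (_ , t≡g)) = inj₂ t≡g
  joins-right (_ , inj₂ (_ , t≡b)) = inj₁ t≡b

  -- Hunting a target vertex.

  -- WMaker hunts a target o ∈ U.  The index bounds the number of moves she needs.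
  data Hunt (B : E) (x v o b : V) (U : List V) : ℕ → Set where
    away          : ∀ {p} → Free B x v p U → ¬ Claimed B x o → b ∉ U → b ≢ x → Hunt B x v o b U 1
    at-target     : ∀ {p} → Free B x v p U → ¬ Claimed B x o → b ≡ o → Hunt B x v o b U 2
    at-maker      : ∀ {p} → Free B x v p U → ¬ Claimed B x o → b ≡ x → Hunt B x v o b U 3
    at-front      : Free B x v b U → ¬ Claimed B x o → b ∈ U → Hunt B x v o b U 4
    elsewhere     : ∀ {p} → Free B x v p U → ¬ Claimed B x o → b ∈ U → Hunt B x v o b U 5
    front-maker   : Free B x v o U → b ≡ x → Hunt B x v o b U 6
    front-target  : Free B x v o U → b ≡ o → Hunt B x v o b U 7
    front-any     : Free B x v o U → Hunt B x v o b U 8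
    threat-away   : Threat B x v o b U → b ≢ x → b ≢ o → Hunt B x v o b U 1
    threat-target : Threat B x v o b U → b ≡ o → Hunt B x v o b U 2
    threat-maker  : Threat B x v o b U → b ≡ x → Hunt B x v o b U 3
    other-threat  : ∀ {c} → Threat B x v c b U → c ≢ o → b ≢ v → Hunt B x v o b U 9
    first-threat  : ∀ {c} → Threat B x v c b U → c ≢ o → Hunt B x v o b U 10

  hunt-sound : ∀ {B x v o b U k} → Hunt B x v o b U k → Sound B x v b U
  hunt-sound (away f _ _ _)       = is-free f
  hunt-sound (at-target f _ _)    = is-free f
  hunt-sound (at-maker f _ _)     = is-free f
  hunt-sound (at-front f _ _)     = is-free f
  hunt-sound (elsewhere f _ _)    = is-free f
  hunt-sound (front-maker f _)    = is-free f
  hunt-sound (front-target f _)   = is-free f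
  hunt-sound (front-any f)        = is-free f
  hunt-sound (threat-away t _ _)  = is-threat t
  hunt-sound (threat-target t _)  = is-threat t
  hunt-sound (threat-maker t _)   = is-threat t
  hunt-sound (other-threat t _ _) = is-threat t
  hunt-sound (first-threat t _)   = is-threat t

  free-hunt : ∀ {B x v o b U p} → o ∈ U → Free B x v p U →
              ∃[ k ] k ≤ 8 × Hunt B x v o b U k
  free-hunt {B} {x} {o = o} {b} {U} o∈ f with claimed? B x o
  ... | yes x∼o with refl ← Free.front f o∈ x∼o = 8 , ≤-refl , front-any f
  ... | no x≁o with b ∈? U | b ≟ x
  ...   | yes b∈ | _       = 5 , ≤ᵇ⇒≤ _ _ _ , elsewhere f x≁o b∈
  ...   | no _   | yes b≡x = 3 , ≤ᵇ⇒≤ _ _ _ , at-maker f x≁o b≡x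
  ...   | no b∉  | no b≢x  = 1 , ≤ᵇ⇒≤ _ _ _ , away f x≁o b∉ b≢x

  -- Ten is the index of the worst entry, a threat at a vertex other than `o`; a free position
  -- enters at index eight at most.
  sound-hunt : ∀ {B x v o b U} → Frame x v U → o ∈ U → Sound B x v b U →
               ∃[ k ] k ≤ 10 × Hunt B x v o b U k
  sound-hunt fr o∈ (is-free f) with k , k≤8 , h ← free-hunt o∈ f = k , ≤-trans k≤8 (≤ᵇ⇒≤ _ _ _) , h
  sound-hunt {x = x} {o = o} {b} fr o∈ (is-threat {c} t) with c ≟ o
  ... | no c≢o   = 10 , ≤-refl , first-threat t c≢o
  ... | yes refl with b ≟ o | b ≟ x
  ...   | yes b≡o | _       = 2 , ≤ᵇ⇒≤ _ _ _ , threat-target t b≡o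
  ...   | no _    | yes b≡x = 3 , ≤ᵇ⇒≤ _ _ _ , threat-maker t b≡x
  ...   | no b≢o  | no b≢x  = 1 , ≤ᵇ⇒≤ _ _ _ , threat-away t b≢x b≢o

  -- One exchange of moves during the hunt.

  module Step {B B′ : E} {x v b g : V} {U : List V}
              (frame : Frame x v U) (ext : Extends B b g B′) where

    open Frame frame

    Choice : (V → List V → Set) → Set
    Choice P = ∃[ y ] (y ∈ U × ¬ Claimed B′ x y × (∀ {U′} → Removed U y U′ → P y U′))

    NoJoin : V → List V → Set
    NoJoin y U′ = ∀ {t} → t ∈ U′ → ¬ Joins b g y t

    -- Since `y` lay in the independent set `U`, no old edge leads from it into `U′`; only
    -- WBreaker's last edge has to be checked. This is why a step into `U` renews the position.
    makeFree : ∀ {y U′} q → Removed U y U′ → y ∈ U → Independent B U →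
      (∀ {t} → t ∈ U′ → ¬ Claimed B v t) →
      (∀ {s t} → s ∈ U′ → t ∈ U′ → ¬ Joins b g s t) →
      NoJoin v U′ →
      (∀ {t} → t ∈ U′ → Joins b g y t → t ≡ q) → Free B′ y v q U′
    makeFree q rm y∈ inn fst no-inner no-first no-front = free
      (λ s∈ t∈ c → [ inn (sub s∈) (sub t∈) , no-inner s∈ t∈ ]′ (ext c))
      (λ t∈ c → [ fst t∈ , no-first t∈ ]′ (ext c))
      (λ t∈ c → [ (λ old → contradiction old (inn y∈ (sub t∈))) , no-front t∈ ]′ (ext c))
      where open Removed rm

    makeThreat : ∀ {y U′} c → Removed U y U′ → y ∈ U → c ∈ U′ → Independent B U →
      (∀ {t} → t ∈ U′ → t ≢ c → ¬ Claimed B v t) →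
      (∀ {s t} → s ∈ U′ → t ∈ U′ → ¬ Joins b g s t) →
      (∀ {t} → t ∈ U′ → t ≢ c → ¬ Joins b g v t) →
      NoJoin y U′ →
      (g ∈ U′ → g ≡ c) → Threat B′ y v c g U′
    makeThreat c rm y∈ c∈ inn fst no-inner no-first no-front home = threat c∈
      (λ s∈ t∈ cl → [ inn (sub s∈) (sub t∈) , no-inner s∈ t∈ ]′ (ext cl))
      (λ t∈ t≢c cl → [ fst t∈ t≢c , no-first t∈ t≢c ]′ (ext cl))
      (λ t∈ cl → [ inn y∈ (sub t∈) , no-front t∈ ]′ (ext cl))
      home
      where open Removed rm

    ≢-∈-∉ : ∀ {s t} → s ∈ U → t ∉ U → s ≢ t
    ≢-∈-∉ s∈ t∉ refl = t∉ s∈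

    old : ∀ {s t} → Claimed B′ s t → ¬ Joins b g s t → Claimed B s t
    old c nj = [ id , (λ j → contradiction j nj) ]′ (ext c)

    -- An edge inside `U` is repaired by visiting one of its ends: the other end becomes the
    -- exceptional endpoint at the front.
    eatNew : Independent B U → (∀ {t} → t ∈ U → ¬ Claimed B v t) → b ∈ U → g ∈ U →
             ∀ {U′} → Removed U g U′ → Free B′ g v b U′
    eatNew inn fst b∈ g∈ rm = makeFree b rm g∈ inn (fst ∘ sub)
      (λ { _ t∈ (_ , inj₁ (_ , refl)) → gone t∈ ; s∈ _ (_ , inj₂ (refl , _)) → gone s∈ })
      (λ { _ (_ , inj₁ (refl , _)) → v∉U b∈ ; _ (_ , inj₂ (refl , _)) → v∉U g∈ })
      (λ { t∈ (_ , inj₁ (_ , refl)) → contradiction t∈ gone ; _ (_ , inj₂ (_ , t≡b)) → t≡b })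
      where open Removed rm

    eatOld : Independent B U → (∀ {t} → t ∈ U → ¬ Claimed B v t) → b ∈ U → g ∈ U →
             ∀ {U′} → Removed U b U′ → Free B′ b v g U′
    eatOld inn fst b∈ g∈ rm = makeFree g rm b∈ inn (fst ∘ sub)
      (λ { s∈ _ (_ , inj₁ (refl , _)) → gone s∈ ; _ t∈ (_ , inj₂ (_ , refl)) → gone t∈ })
      (λ { _ (_ , inj₁ (refl , _)) → v∉U b∈ ; _ (_ , inj₂ (refl , _)) → v∉U g∈ })
      (λ { _ (_ , inj₁ (_ , t≡g)) → t≡g ; t∈ (_ , inj₂ (_ , refl)) → contradiction t∈ gone })
      where open Removed rm

    outside-old : b ∈ U → g ∈ U → ∀ {t} → Claimed B′ x t → Claimed B x t
    outside-old b∈ g∈ c = old c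
      (λ { (_ , inj₁ (refl , _)) → x∉U b∈ ; (_ , inj₂ (refl , _)) → x∉U g∈ })

    module _ {o} (o∈U : o ∈ U) where

      -- The constructors record where WBreaker stood before his move, so that `huntStep` can
      -- exclude outcomes that would not lower the index.
      data Clear (y : V) (U′ : List V) : Set where
        caught : y ≡ o → Sound B′ y v g U′ → Clear y U′
        clear₁ : y ≢ o → b ≡ o → Hunt B′ y v o g U′ 1 → Clear y U′
        clear₂ : y ≢ o → b ≡ x → Hunt B′ y v o g U′ 2 → Clear y U′
        clear₃ : y ≢ o → b ∈ U → b ≢ o → Hunt B′ y v o g U′ 3 → Clear y U′
        clear₄ : y ≢ o → b ∈ U → b ≢ o → ¬ Free B x v b U → Hunt B′ y v o g U′ 4 → Clear y U′

      -- WMaker takes `o` unless WBreaker has just claimed `xo`, which leaves him at `x` or `o`, or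
      -- has played inside `U` away from `o`. In the latter case she visits `g`, or `b` if `xg` is
      -- claimed; then `g` is the exceptional vertex, so `xb` is open.
      stepClear : ∀ {p} → 3 ≤ length U → Free B x v p U → ¬ Claimed B x o → Choice Clear
      stepClear {p} 3≤U f x≁o with claimed? B′ x o
      ... | yes x∼′o = spoilt
        where
        open Free f
        xo : Joins b g x o
        xo = [ (λ c → contradiction c x≁o) , id ]′ (ext x∼′o)
        only : ∀ {s t} → Joins b g s t → (s ≡ x × t ≡ o) ⊎ (s ≡ o × t ≡ x)
        only (_ , j) with proj₂ xo | j
        ... | inj₁ (refl , refl) | e = e
        ... | inj₂ (refl , refl) | inj₁ (e , e′) = inj₂ (e , e′)
        ... | inj₂ (refl , refl) | inj₂ (e , e′) = inj₁ (e , e′)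
        spoilt : Choice Clear
        -- Only `p` can be an old neighbour of `x` in `U`, and `xo` is WBreaker's new edge; any
        -- third vertex is reachable.
        spoilt with y , y∈ , y∉ ← avoiding (p ∷ o ∷ []) U unique 3≤U = y , y∈ , x≁′y , result
          where
          y≢o : y ≢ o
          y≢o refl = y∉ (there (here refl))
          y≢x : y ≢ x
          y≢x = ≢-∈-∉ y∈ x∉U
          x≁′y : ¬ Claimed B′ x y
          x≁′y c with ext c
          ... | inj₁ c′ = y∉ (here (front y∈ c′))
          ... | inj₂ j with only j
          ...   | inj₁ (_ , refl) = y≢o refl
          ...   | inj₂ (refl , _) = x∉U o∈U
          y-apart : ∀ {t} → ¬ Joins b g y t
          y-apart j with only j
          ... | inj₁ (y≡x , _) = y≢x y≡x
          ... | inj₂ (y≡o , _) = y≢o y≡o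
          result : ∀ {U′} → Removed U y U′ → Clear y U′
          result rm = finish (proj₂ xo)
            where
            open Removed rm
            f′ : Free B′ y v y _
            f′ = makeFree y rm y∈ inner (first ∘ sub)
              (λ s∈ t∈ j → case only j of λ where
                (inj₁ (refl , _)) → x∉U (sub s∈)
                (inj₂ (_ , refl)) → x∉U (sub t∈))
              (λ t∈ j → case only j of λ where
                (inj₁ (v≡x , _)) → x≢v (sym v≡x)
                (inj₂ (refl , _)) → v∉U o∈U)
              (λ _ j → contradiction j y-apart)
            y≁′o : ¬ Claimed B′ y o
            y≁′o c = inner y∈ o∈U (old c y-apart)
            finish : (x ≡ b × o ≡ g) ⊎ (x ≡ g × o ≡ b) → Clear y _
            finish (inj₁ (refl , refl)) = clear₂ y≢o refl (at-target f′ y≁′o refl)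
            finish (inj₂ (refl , refl)) = clear₁ y≢o refl (away f′ y≁′o (x∉U ∘ sub) (≢-sym y≢x))
      ... | no x≁′o with place v b g U v∉U
      ...   | harmless no-inner no-first = o , o∈U , x≁′o , λ rm →
              let open Removed rm in
              caught refl (is-free (makeFree o rm o∈U inner (first ∘ sub)
                (λ s∈ t∈ → no-inner (sub s∈) (sub t∈)) (no-first ∘ sub)
                (λ t∈ j → contradiction j (no-inner o∈U (sub t∈)))))
        where open Free f
      ...   | at-first {u} u∈ g-at only with u ≟ o
      ...     | yes refl = o , o∈U , x≁′o , λ rm →
                let open Removed rm in
                caught refl (is-free (makeFree o rm o∈U inner (first ∘ sub)
                  (λ s∈ t∈ j → case only j of λ where
                    (inj₁ (refl , _)) → v∉U (sub s∈)
                    (inj₂ (_ , refl)) → v∉U (sub t∈))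
                  (λ t∈ j → case only j of λ where
                    (inj₁ (_ , refl)) → gone t∈
                    (inj₂ (_ , refl)) → v∉U (sub t∈))
                  (λ t∈ j → case only j of λ where
                    (inj₁ (refl , _)) → ⊥-elim (v∉U o∈U)
                    (inj₂ (_ , refl)) → ⊥-elim (v∉U (sub t∈)))))
        where open Free f
      ...     | no u≢o = o , o∈U , x≁′o , λ rm →
                let open Removed rm in
                caught refl (is-threat (makeThreat u rm o∈U (back u∈ u≢o) inner (λ t∈ _ → first (sub t∈))
                  (λ s∈ t∈ j → case only j of λ where
                    (inj₁ (refl , _)) → v∉U (sub s∈)
                    (inj₂ (_ , refl)) → v∉U (sub t∈))
                  (λ t∈ t≢u j → case only j of λ where
                    (inj₁ (_ , t≡u)) → t≢u t≡u
                    (inj₂ (_ , refl)) → v∉U (sub t∈))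
                  (λ t∈ j → case only j of λ where
                    (inj₁ (refl , _)) → v∉U o∈U
                    (inj₂ (o≡u , _)) → u≢o (sym o≡u))
                  (λ g∈ → [ (λ { refl → ⊥-elim (v∉U (sub g∈)) }) , id ]′ g-at)))
        where open Free f
      stepClear {p} 3≤U f x≁o | no x≁′o | inside b∈ g∈ b≢g with b ≟ o | g ≟ o
      ... | yes refl | _ = o , o∈U , x≁′o , λ rm → caught refl (is-free (eatOld inner first b∈ g∈ rm))
        where open Free f
      ... | no _ | yes refl = o , o∈U , x≁′o , λ rm → caught refl (is-free (eatNew inner first b∈ g∈ rm))
        where open Free f
      ... | no b≢o | no g≢o with claimed? B′ x g
      ...   | no x≁′g = g , g∈ , x≁′g , λ rm →
              clear₃ g≢o b∈ b≢o (at-maker (eatNew inner first b∈ g∈ rm) (apart g∈) refl)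
        where
        open Free f
        apart : ∀ {s} → s ∈ U → ¬ Claimed B′ s o
        apart s∈ c = inner s∈ o∈U (old c
          (λ { (_ , inj₁ (_ , o≡g)) → g≢o (sym o≡g) ; (_ , inj₂ (_ , o≡b)) → b≢o (sym o≡b) }))
      -- The edge `xg` is old, so `g` and not `b` is exceptional. This rules out `at-front` as the
      -- previous state.
      ...   | yes x∼′g = b , b∈ , x≁′b , λ rm →
              clear₄ b≢o b∈ b≢o (λ f′ → b≢g (sym (Free.front f′ g∈ x∼g)))
                (at-front (eatOld inner first b∈ g∈ rm) (apart b∈) (Removed.back rm g∈ (≢-sym b≢g)))
        where
        open Free f
        apart : ∀ {s} → s ∈ U → ¬ Claimed B′ s o
        apart s∈ c = inner s∈ o∈U (old c
          (λ { (_ , inj₁ (_ , o≡g)) → g≢o (sym o≡g) ; (_ , inj₂ (_ , o≡b)) → b≢o (sym o≡b) }))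
        x∼g : Claimed B x g
        x∼g = outside-old b∈ g∈ x∼′g
        x≁′b : ¬ Claimed B′ x b
        x≁′b c = b≢g (trans (front b∈ (outside-old b∈ g∈ c)) (sym (front g∈ x∼g)))

      not-joined-left : ∀ {y t : V} → y ≢ b → y ≢ g → ¬ Joins b g y t
      not-joined-left y≢b y≢g j = [ y≢b , y≢g ]′ (joins-left j)

      not-joined-right : ∀ {s y : V} → y ≢ b → y ≢ g → ¬ Joins b g s y
      not-joined-right y≢b y≢g j = [ y≢b , y≢g ]′ (joins-right j)

      record Spare : Set where
        field
          y   : V
          y∈  : y ∈ U
          y≢o : y ≢ o
          y≢b : y ≢ b
          y≢g : y ≢ g

      spare : 4 ≤ length U → Spare
      spare 4≤U with y , y∈ , y∉ ← avoiding (o ∷ b ∷ g ∷ []) U unique 4≤U = record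
        { y = y ; y∈ = y∈ ; y≢o = λ e → y∉ (here e)
        ; y≢b = λ e → y∉ (there (here e)) ; y≢g = λ e → y∉ (there (there (here e))) }

      data Front (y : V) (U′ : List V) : Set where
        freed : ∀ {k} → y ≢ o → k ≤ 5 → Hunt B′ y v o g U′ k → Front y U′
        left₆ : y ≢ o → b ∈ U → Hunt B′ y v o g U′ 6 → Front y U′
        left₇ : y ≢ o → b ∈ U → b ≢ o → Hunt B′ y v o g U′ 7 → Front y U′

      -- As `xo` may be claimed, WMaker steps aside to a vertex from which, by independence, `o` is
      -- open. Only an edge that WBreaker draws inside `U` at `o` defeats this: visiting its other
      -- end leaves `o` exceptional, but with him at her new position or at `o`.
      stepFront : 4 ≤ length U → Free B x v o U → Choice Front
      stepFront 4≤U f with place v b g U v∉U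
      ... | harmless no-inner no-first = y , y∈ , x≁′y , λ rm → freed y≢o (result-bound rm) (result rm)
        where
        open Free f
        open Spare (spare 4≤U)
        x≁′y : ¬ Claimed B′ x y
        x≁′y c = y≢o (front y∈ (old c (not-joined-right y≢b y≢g)))
        -- No edge leads from `y` into what remains of `U`, so any vertex may be named exceptional;
        -- naming `g` gives `at-front`.
        f′ : ∀ q {U′} → Removed U y U′ → Free B′ y v q U′
        f′ q rm = makeFree q rm y∈ inner (first ∘ sub) (λ s∈ t∈ → no-inner (sub s∈) (sub t∈))
          (no-first ∘ sub) (λ _ j → contradiction j (not-joined-left y≢b y≢g))
          where open Removed rm
        y≁′o : ¬ Claimed B′ y o
        y≁′o c = inner y∈ o∈U (old c (not-joined-left y≢b y≢g))
        rank : List V → ℕ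
        rank U′ with g ∈? U′
        ... | yes _ = 4
        ... | no _  = 1
        result-bound : ∀ {U′} → Removed U y U′ → rank U′ ≤ 5
        result-bound {U′} _ with g ∈? U′
        ... | yes _ = ≤ᵇ⇒≤ _ _ _
        ... | no _  = ≤ᵇ⇒≤ _ _ _
        result : ∀ {U′} (rm : Removed U y U′) → Hunt B′ y v o g U′ (rank U′)
        result {U′} rm with g ∈? U′
        ... | yes g∈ = at-front (f′ g rm) y≁′o g∈
        ... | no g∉  = away (f′ g rm) y≁′o g∉ (≢-sym y≢g)
      ... | at-first {u} u∈ g-at only with u ≟ o
      ...   | yes refl = y , y∈ , x≁′y , λ rm → result rm g-at
        where
        open Free f
        open Spare (spare 4≤U)
        x≁′y : ¬ Claimed B′ x y
        x≁′y c = y≢o (front y∈ (old c (not-joined-right y≢b y≢g)))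
        t′ : ∀ {U′} → Removed U y U′ → Threat B′ y v o g U′
        t′ rm = makeThreat o rm y∈ (back o∈U (≢-sym y≢o)) inner (λ t∈ _ → first (sub t∈))
          (λ s∈ t∈ j → case only j of λ where
            (inj₁ (refl , _)) → v∉U (sub s∈)
            (inj₂ (_ , refl)) → v∉U (sub t∈))
          (λ t∈ t≢o j → case only j of λ where
            (inj₁ (_ , t≡o)) → t≢o t≡o
            (inj₂ (_ , refl)) → v∉U (sub t∈))
          (λ _ → not-joined-left y≢b y≢g)
          (λ g∈ → [ (λ { refl → ⊥-elim (v∉U (sub g∈)) }) , id ]′ g-at)
          where open Removed rm
        result : ∀ {U′} → Removed U y U′ → g ≡ v ⊎ g ≡ o → Front y U′
        result rm (inj₁ refl) = freed y≢o (≤ᵇ⇒≤ _ _ _)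
          (threat-away (t′ rm) (≢-sym y≢g) (≢-sym (≢-∈-∉ o∈U v∉U)))
        result rm (inj₂ refl) = freed y≢o (≤ᵇ⇒≤ _ _ _) (threat-target (t′ rm) refl)
      ...   | no u≢o = u , u∈ , x≁′u , λ rm → result rm g-at
        where
        open Free f
        x≁′u : ¬ Claimed B′ x u
        x≁′u c with ext c
        ... | inj₁ c′ = u≢o (front u∈ c′)
        ... | inj₂ j with only j
        ...   | inj₁ (refl , _) = x≢v refl
        ...   | inj₂ (_ , refl) = v∉U u∈
        f′ : ∀ {U′} → Removed U u U′ → Free B′ u v u U′
        f′ rm = makeFree u rm u∈ inner (first ∘ sub)
          (λ s∈ t∈ j → case only j of λ where
            (inj₁ (refl , _)) → v∉U (sub s∈)
            (inj₂ (_ , refl)) → v∉U (sub t∈))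
          (λ t∈ j → case only j of λ where
            (inj₁ (_ , refl)) → gone t∈
            (inj₂ (_ , refl)) → v∉U (sub t∈))
          (λ t∈ j → case only j of λ where
            (inj₁ (_ , t≡u)) → t≡u
            (inj₂ (_ , refl)) → ⊥-elim (v∉U (sub t∈)))
          where open Removed rm
        u≁′o : ¬ Claimed B′ u o
        u≁′o c = inner u∈ o∈U (old c λ j → case only j of λ where
          (inj₁ (refl , _)) → v∉U u∈
          (inj₂ (_ , refl)) → v∉U o∈U)
        result : ∀ {U′} → Removed U u U′ → g ≡ v ⊎ g ≡ u → Front u U′
        result rm (inj₁ refl) = freed u≢o (≤ᵇ⇒≤ _ _ _)
          (away (f′ rm) u≁′o (v∉U ∘ Removed.sub rm) (≢-sym (≢-∈-∉ u∈ v∉U)))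
        result rm (inj₂ refl) = freed u≢o (≤ᵇ⇒≤ _ _ _) (at-maker (f′ rm) u≁′o refl)
      stepFront 4≤U f | inside b∈ g∈ b≢g with b ≟ o | g ≟ o
      ... | yes refl | _ = g , g∈
        , (λ c → b≢g (sym (front g∈ (outside-old b∈ g∈ c))))
        , λ rm → left₆ (≢-sym b≢g) b∈ (front-maker (eatNew inner first b∈ g∈ rm) refl)
        where open Free f
      ... | no b≢o | yes refl = b , b∈
        , (λ c → b≢g (front b∈ (outside-old b∈ g∈ c)))
        , λ rm → left₇ b≢g b∈ b≢o (front-target (eatOld inner first b∈ g∈ rm) refl)
        where open Free f
      ... | no b≢o | no g≢o = g , g∈
        , (λ c → g≢o (front g∈ (outside-old b∈ g∈ c)))
        , λ rm → freed g≢o (≤ᵇ⇒≤ _ _ _) (at-maker (eatNew inner first b∈ g∈ rm) g≁′o refl)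
        where
        open Free f
        g≁′o : ¬ Claimed B′ g o
        g≁′o c = inner g∈ o∈U (old c
          (λ { (_ , inj₁ (_ , o≡g)) → g≢o (sym o≡g) ; (_ , inj₂ (_ , o≡b)) → b≢o (sym o≡b) }))

      module Threatened {c} (t : Threat B x v c b U) where

        open Threat t

        -- WBreaker starts outside `U` or at `c`, hence outside `U` once `c` is visited, so he draws
        -- no edge inside what remains. A new edge from `v` is excluded by hypothesis, and only `cg`
        -- can survive.
        eatFree : ¬ (b ≡ v × g ∈ U × g ≢ c) → ∀ {U′} → Removed U c U′ → Free B′ c v g U′
        eatFree not-first rm = makeFree g rm c∈U inner (λ t∈ → first (sub t∈) (λ { refl → gone t∈ }))
          (λ { s∈ t∈ (_ , inj₁ (refl , _)) → b∉ s∈ ; s∈ t∈ (_ , inj₂ (_ , refl)) → b∉ t∈ })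
          (λ { t∈ (_ , inj₁ (refl , refl)) → not-first (refl , sub t∈ , λ { refl → gone t∈ })
             ; t∈ (_ , inj₂ (_ , refl)) → b∉ t∈ })
          (λ { _ (_ , inj₁ (_ , t≡g)) → t≡g ; t∈ (_ , inj₂ (_ , refl)) → ⊥-elim (b∉ t∈) })
          where
          open Removed rm
          b∉ : b ∉ _
          b∉ b∈ with refl ← home (sub b∈) = gone b∈

        eatThreat : b ≡ v → g ∈ U → g ≢ c → ∀ {U′} → Removed U c U′ → Threat B′ c v g g U′
        eatThreat refl g∈ g≢c rm = makeThreat g rm c∈U (back g∈ g≢c) inner
          (λ t∈ _ → first (sub t∈) (λ { refl → gone t∈ }))
          (λ { s∈ t∈ (_ , inj₁ (refl , _)) → v∉U (sub s∈) ; s∈ t∈ (_ , inj₂ (_ , refl)) → v∉U (sub t∈) })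
          (λ { t∈ t≢g (_ , inj₁ (_ , t≡g)) → t≢g t≡g ; t∈ _ (_ , inj₂ (_ , refl)) → v∉U (sub t∈) })
          (λ { t∈ (_ , inj₁ (refl , _)) → v∉U c∈U ; t∈ (_ , inj₂ (c≡g , _)) → g≢c (sym c≡g) })
          (λ _ → refl)
          where open Removed rm

        first-edge? : Dec (b ≡ v × g ∈ U × g ≢ c)
        first-edge? = (b ≟ v) ×-dec (g ∈? U) ×-dec (¬? (g ≟ c))

        joined : Claimed B′ x c → Joins b g x c
        joined x∼c = [ (λ o → contradiction o (front c∈U)) , id ]′ (ext x∼c)

        -- Blocking `xc` uses up WBreaker's move and leaves him at `x` or `c`, so the threat at `c`
        -- persists whichever other `y` is visited.
        moveAside : Joins b g x c → ∀ {y U′} → y ≢ c → y ∈ U → Removed U y U′ → Threat B′ y v c g U′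
        moveAside xc {y} y≢c y∈ rm = makeThreat c rm y∈ (back c∈U (≢-sym y≢c)) inner
          (λ t∈ → first (sub t∈))
          (λ s∈ t∈ j → case only j of λ where
            (inj₁ (refl , _)) → x∉U (sub s∈)
            (inj₂ (_ , refl)) → x∉U (sub t∈))
          (λ t∈ t≢c j → case only j of λ where
            (inj₁ (_ , t≡c)) → t≢c t≡c
            (inj₂ (_ , refl)) → x∉U (sub t∈))
          (λ t∈ j → case only j of λ where
            (inj₁ (refl , _)) → x∉U y∈
            (inj₂ (y≡c , _)) → y≢c y≡c)
          home′
          where
          open Removed rm
          only : ∀ {s t} → Joins b g s t → (s ≡ x × t ≡ c) ⊎ (s ≡ c × t ≡ x)
          only (_ , j) with proj₂ xc | j
          ... | inj₁ (refl , refl) | e = e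
          ... | inj₂ (refl , refl) | inj₁ (e , e′) = inj₂ (e , e′)
          ... | inj₂ (refl , refl) | inj₂ (e , e′) = inj₁ (e , e′)
          home′ : g ∈ _ → g ≡ c
          home′ g∈ with proj₂ xc
          ... | inj₁ (_ , refl) = refl
          ... | inj₂ (refl , _) = ⊥-elim (x∉U (sub g∈))

        beside : Joins b g x c → ∀ {y} → y ≢ c → y ∈ U → ¬ Claimed B′ x y
        beside xc y≢c y∈ x∼y with ext x∼y | proj₂ xc
        ... | inj₁ o | _ = front y∈ o
        ... | inj₂ (_ , inj₁ (_ , refl)) | inj₁ (_ , refl) = y≢c refl
        ... | inj₂ (_ , inj₂ (_ , refl)) | inj₁ (refl , _) = x∉U y∈
        ... | inj₂ (_ , inj₁ (_ , refl)) | inj₂ (refl , _) = x∉U y∈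
        ... | inj₂ (_ , inj₂ (_ , refl)) | inj₂ (_ , refl) = y≢c refl

      data Target (y : V) (U′ : List V) : Set where
        caught : y ≡ o → Sound B′ y v g U′ → Target y U′
        left₁  : y ≢ o → b ≡ o → Hunt B′ y v o g U′ 1 → Target y U′
        left₂  : y ≢ o → b ≡ x → Hunt B′ y v o g U′ 2 → Target y U′

      stepThreat : 4 ≤ length U → Threat B x v o b U → Choice Target
      stepThreat 4≤U t with claimed? B′ x o
      ... | no x≁′o = o , o∈U , x≁′o , result
        where
        open Threatened t
        result : ∀ {U′} → Removed U o U′ → Target o U′
        result rm with first-edge?
        ... | yes (b≡v , g∈ , g≢o) = caught refl (is-threat (eatThreat b≡v g∈ g≢o rm))
        ... | no not-first         = caught refl (is-free (eatFree not-first rm))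
      ... | yes x∼′o = y , y∈ , beside (joined x∼′o) y≢o y∈ , λ rm → result rm (proj₂ (joined x∼′o))
        where
        open Threatened t
        open Spare (spare 4≤U)
        result : ∀ {U′} → Removed U y U′ → (x ≡ b × o ≡ g) ⊎ (x ≡ g × o ≡ b) → Target y U′
        result rm (inj₁ (x≡b , o≡g)) = left₂ y≢o (sym x≡b)
          (threat-target (moveAside (joined x∼′o) y≢o y∈ rm) (sym o≡g))
        result rm (inj₂ (refl , refl)) = left₁ y≢o refl
          (threat-away (moveAside (joined x∼′o) y≢o y∈ rm) (≢-sym y≢g) (≢-sym (≢-∈-∉ o∈U x∉U)))

      data Other (y : V) (U′ : List V) : Set where
        caught : y ≡ o → Sound B′ y v g U′ → Other y U′
        left₈  : ∀ {k} → y ≢ o → k ≤ 8 → Hunt B′ y v o g U′ k → Other y U′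
        left₉  : y ≢ o → b ≡ v → Hunt B′ y v o g U′ 9 → Other y U′

      -- If WBreaker blocks `xc`, he cannot also block `xo`. Otherwise visiting `c` ends the threat,
      -- unless he stood at `v` and makes a new one; he has then left `v` and cannot do so twice
      -- running.
      stepOther : ∀ {c} → Threat B x v c b U → c ≢ o → Choice Other
      stepOther {c} t c≢o with claimed? B′ x c
      ... | yes x∼′c = o , o∈U , beside (joined x∼′c) (≢-sym c≢o) o∈U , λ rm →
              caught refl (is-threat (moveAside (joined x∼′c) (≢-sym c≢o) o∈U rm))
        where open Threatened t
      ... | no x≁′c = c , Threat.c∈U t , x≁′c , result
        where
        open Threatened t
        result : ∀ {U′} → Removed U c U′ → Other c U′
        result rm with first-edge?
        ... | no not-first with k , k≤8 , h ← free-hunt (Removed.back rm o∈U (≢-sym c≢o)) (eatFree not-first rm) =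
                left₈ c≢o k≤8 h
        ... | yes (b≡v , g∈ , g≢c) with g ≟ o
        ...   | yes refl = left₈ c≢o (≤ᵇ⇒≤ _ _ _) (threat-target (eatThreat b≡v g∈ g≢c rm) refl)
        ...   | no g≢o   = left₉ c≢o b≡v (other-threat (eatThreat b≡v g∈ g≢c rm) g≢o (≢-∈-∉ g∈ v∉U))

      data Outcome (k : ℕ) (y : V) (U′ : List V) : Set where
        caught  : y ≡ o → Sound B′ y v g U′ → Outcome k y U′
        hunting : ∀ {j} → y ≢ o → j < k → Hunt B′ y v o g U′ j → Outcome k y U′

      weaken : ∀ {P Q : V → List V → Set} → (∀ {y U′} → P y U′ → Q y U′) → Choice P → Choice Q
      weaken f (y , y∈ , x≁y , p) = y , y∈ , x≁y , λ rm → f (p rm)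

      -- The order of the indices makes every outcome short of a catch a descent, once those
      -- incompatible with WBreaker's previous position are discarded.
      huntStep : ∀ {k} → 4 ≤ length U → Hunt B x v o b U k → Choice (Outcome k)
      huntStep 4≤U (away f x≁o b∉ b≢x) = weaken (λ where
        (caught y≡o s)      → caught y≡o s
        (clear₁ _ refl _)     → contradiction o∈U b∉
        (clear₂ _ b≡x _)      → contradiction b≡x b≢x
        (clear₃ _ b∈ _ _)     → contradiction b∈ b∉
        (clear₄ _ b∈ _ _ _)   → contradiction b∈ b∉) (stepClear (<⇒≤ 4≤U) f x≁o)
      huntStep 4≤U (at-target f x≁o b≡o) = weaken (λ where
        (caught y≡o s)      → caught y≡o s
        (clear₁ y≢o _ h)      → hunting y≢o (≤ᵇ⇒≤ _ _ _) h
        (clear₂ _ refl _)     → contradiction (subst (_∈ U) (sym b≡o) o∈U) x∉U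
        (clear₃ _ _ b≢o _)    → contradiction b≡o b≢o
        (clear₄ _ _ b≢o _ _)  → contradiction b≡o b≢o) (stepClear (<⇒≤ 4≤U) f x≁o)
      huntStep 4≤U (at-maker f x≁o refl) = weaken (λ where
        (caught y≡o s)      → caught y≡o s
        (clear₁ y≢o _ h)      → hunting y≢o (≤ᵇ⇒≤ _ _ _) h
        (clear₂ y≢o _ h)      → hunting y≢o (≤ᵇ⇒≤ _ _ _) h
        (clear₃ _ b∈ _ _)     → contradiction b∈ x∉U
        (clear₄ _ b∈ _ _ _)   → contradiction b∈ x∉U) (stepClear (<⇒≤ 4≤U) f x≁o)
      huntStep 4≤U (at-front f x≁o _) = weaken (λ where
        (caught y≡o s)      → caught y≡o s
        (clear₁ y≢o _ h)      → hunting y≢o (≤ᵇ⇒≤ _ _ _) h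
        (clear₂ y≢o _ h)      → hunting y≢o (≤ᵇ⇒≤ _ _ _) h
        (clear₃ y≢o _ _ h)    → hunting y≢o (≤ᵇ⇒≤ _ _ _) h
        (clear₄ _ _ _ ¬f _)   → contradiction f ¬f) (stepClear (<⇒≤ 4≤U) f x≁o)
      huntStep 4≤U (elsewhere f x≁o _) = weaken (λ where
        (caught y≡o s)      → caught y≡o s
        (clear₁ y≢o _ h)      → hunting y≢o (≤ᵇ⇒≤ _ _ _) h
        (clear₂ y≢o _ h)      → hunting y≢o (≤ᵇ⇒≤ _ _ _) h
        (clear₃ y≢o _ _ h)    → hunting y≢o (≤ᵇ⇒≤ _ _ _) h
        (clear₄ y≢o _ _ _ h)  → hunting y≢o (≤ᵇ⇒≤ _ _ _) h) (stepClear (<⇒≤ 4≤U) f x≁o)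
      huntStep 4≤U (front-maker f refl) = weaken (λ where
        (freed y≢o k≤5 h)     → hunting y≢o (s≤s k≤5) h
        (left₆ _ b∈ _)        → contradiction b∈ x∉U
        (left₇ _ b∈ _ _)      → contradiction b∈ x∉U) (stepFront 4≤U f)
      huntStep 4≤U (front-target f b≡o) = weaken (λ where
        (freed y≢o k≤5 h)     → hunting y≢o (s≤s (m≤n⇒m≤1+n k≤5)) h
        (left₆ y≢o _ h)       → hunting y≢o (≤ᵇ⇒≤ _ _ _) h
        (left₇ _ _ b≢o _)     → contradiction b≡o b≢o) (stepFront 4≤U f)
      huntStep 4≤U (front-any f) = weaken (λ where
        (freed y≢o k≤5 h)     → hunting y≢o (s≤s (m≤n⇒m≤1+n (m≤n⇒m≤1+n k≤5))) h
        (left₆ y≢o _ h)       → hunting y≢o (≤ᵇ⇒≤ _ _ _) h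
        (left₇ y≢o _ _ h)     → hunting y≢o (≤ᵇ⇒≤ _ _ _) h) (stepFront 4≤U f)
      huntStep 4≤U (threat-away t b≢x b≢o) = weaken (λ where
        (caught y≡o s)      → caught y≡o s
        (left₁ _ b≡o _)       → contradiction b≡o b≢o
        (left₂ _ b≡x _)       → contradiction b≡x b≢x) (stepThreat 4≤U t)
      huntStep 4≤U (threat-target t b≡o) = weaken (λ where
        (caught y≡o s)      → caught y≡o s
        (left₁ y≢o _ h)       → hunting y≢o (≤ᵇ⇒≤ _ _ _) h
        (left₂ _ refl _)      → contradiction (subst (_∈ U) (sym b≡o) o∈U) x∉U) (stepThreat 4≤U t)
      huntStep 4≤U (threat-maker t _) = weaken (λ where
        (caught y≡o s)      → caught y≡o s
        (left₁ y≢o _ h)       → hunting y≢o (≤ᵇ⇒≤ _ _ _) h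
        (left₂ y≢o _ h)       → hunting y≢o (≤ᵇ⇒≤ _ _ _) h) (stepThreat 4≤U t)
      huntStep 4≤U (other-threat t c≢o b≢v) = weaken (λ where
        (caught y≡o s)      → caught y≡o s
        (left₈ y≢o k≤8 h)     → hunting y≢o (s≤s k≤8) h
        (left₉ _ b≡v _)       → contradiction b≡v b≢v) (stepOther t c≢o)
      huntStep 4≤U (first-threat t c≢o) = weaken (λ where
        (caught y≡o s)      → caught y≡o s
        (left₈ y≢o k≤8 h)     → hunting y≢o (s≤s (m≤n⇒m≤1+n k≤8)) h
        (left₉ y≢o _ h)       → hunting y≢o (≤ᵇ⇒≤ _ _ _) h) (stepOther t c≢o)

  -- Vertices from which to close the cycle.

  -- From v WBreaker can spoil the closing edge at w₁, but then he stands at w₁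
  -- and cannot spoil the one at w₂.
  record Closers (B′ : E) (x v g : V) (U : List V) : Set where
    field
      {w₁}   : V
      w₁∈    : w₁ ∈ U
      x≁w₁   : ¬ Claimed B′ x w₁
      v≁w₁   : ¬ Claimed B′ v w₁
      g≢w₁   : g ≢ w₁
      second : g ≡ v → ∃[ w₂ ] (w₂ ∈ U × w₂ ≢ w₁ × ¬ Claimed B′ w₁ w₂ × ¬ Claimed B′ v w₂)

  module _ {B B′ : E} {x v b g : V} {U : List V} (frame : Frame x v U)
           (ext : Extends B b g B′) (3≤U : 3 ≤ length U) where

    open Frame frame

    private
      fresh : ∀ {s t} → ¬ Claimed B s t → ¬ Joins b g s t → ¬ Claimed B′ s t
      fresh no-old no-new c = [ no-old , no-new ]′ (ext c)

      first∉ : ∀ {s} → s ∈ U → s ≢ v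
      first∉ s∈ refl = v∉U s∈

      maker∉ : ∀ {s} → s ∈ U → s ≢ x
      maker∉ s∈ refl = x∉U s∈

    -- In the free case it suffices to avoid `p` and the one end of WBreaker's last edge that may
    -- now be joined to `v` or `x`. In the threat case `c` and `g` are avoided, and with them `b`,
    -- which inside `U` could only be `c`.
    closers : Sound B x v b U → Closers B′ x v g U
    closers (is-free {p} f) with g ≟ v | g ≟ x
    ... | yes refl | _
      with w₁ , w₁∈ , w₁∉ ← avoiding (b ∷ p ∷ []) U unique 3≤U
      with w₂ , w₂∈ , w₂∉ ← avoiding (b ∷ w₁ ∷ []) U unique 3≤U = record
        { w₁∈  = w₁∈
        ; x≁w₁ = fresh (λ c → w₁∉ (there (here (front w₁∈ c)))) λ where
            (_ , inj₁ (_ , w₁≡v)) → first∉ w₁∈ w₁≡v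
            (_ , inj₂ (_ , w₁≡b)) → w₁∉ (here w₁≡b)
        ; v≁w₁ = fresh (first w₁∈) λ where
            (_ , inj₁ (_ , w₁≡v)) → first∉ w₁∈ w₁≡v
            (_ , inj₂ (_ , w₁≡b)) → w₁∉ (here w₁≡b)
        ; g≢w₁ = ≢-sym (first∉ w₁∈)
        ; second = λ _ → w₂ , w₂∈ , (λ e → w₂∉ (there (here e)))
            , fresh (inner w₁∈ w₂∈) (λ where
                (_ , inj₁ (w₁≡b , _)) → w₁∉ (here w₁≡b)
                (_ , inj₂ (w₁≡v , _)) → first∉ w₁∈ w₁≡v)
            , fresh (first w₂∈) (λ where
                (_ , inj₁ (_ , w₂≡v)) → first∉ w₂∈ w₂≡v
                (_ , inj₂ (_ , w₂≡b)) → w₂∉ (here w₂≡b))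
        }
      where open Free f
    ... | no g≢v | yes refl
      with w₁ , w₁∈ , w₁∉ ← avoiding (b ∷ p ∷ []) U unique 3≤U = record
        { w₁∈  = w₁∈
        ; x≁w₁ = fresh (λ c → w₁∉ (there (here (front w₁∈ c)))) λ where
            (_ , inj₁ (_ , w₁≡x)) → maker∉ w₁∈ w₁≡x
            (_ , inj₂ (_ , w₁≡b)) → w₁∉ (here w₁≡b)
        ; v≁w₁ = fresh (first w₁∈) λ where
            (_ , inj₁ (_ , w₁≡x)) → maker∉ w₁∈ w₁≡x
            (_ , inj₂ (v≡x , _)) → x≢v (sym v≡x)
        ; g≢w₁ = ≢-sym (maker∉ w₁∈)
        ; second = λ g≡v → contradiction g≡v g≢v
        }
      where open Free f
    ... | no g≢v | no g≢x
      with w₁ , w₁∈ , w₁∉ ← avoiding (g ∷ p ∷ []) U unique 3≤U = record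
        { w₁∈  = w₁∈
        ; x≁w₁ = fresh (λ c → w₁∉ (there (here (front w₁∈ c)))) λ where
            (_ , inj₁ (_ , w₁≡g)) → w₁∉ (here w₁≡g)
            (_ , inj₂ (x≡g , _)) → g≢x (sym x≡g)
        ; v≁w₁ = fresh (first w₁∈) λ where
            (_ , inj₁ (_ , w₁≡g)) → w₁∉ (here w₁≡g)
            (_ , inj₂ (v≡g , _)) → g≢v (sym v≡g)
        ; g≢w₁ = λ g≡w₁ → w₁∉ (here (sym g≡w₁))
        ; second = λ g≡v → contradiction g≡v g≢v
        }
      where open Free f
    closers (is-threat {c} t)
      with w₁ , w₁∈ , w₁∉ ← avoiding (c ∷ g ∷ []) U unique 3≤U
      with w₂ , w₂∈ , w₂∉ ← avoiding (c ∷ w₁ ∷ []) U unique 3≤U = record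
        { w₁∈  = w₁∈
        ; x≁w₁ = fresh (front w₁∈) λ where
            (_ , inj₁ (_ , w₁≡g)) → w₁≢g w₁≡g
            (_ , inj₂ (_ , w₁≡b)) → w₁≢b w₁≡b
        ; v≁w₁ = fresh (first w₁∈ (λ e → w₁∉ (here e))) λ where
            (_ , inj₁ (_ , w₁≡g)) → w₁≢g w₁≡g
            (_ , inj₂ (_ , w₁≡b)) → w₁≢b w₁≡b
        ; g≢w₁ = ≢-sym w₁≢g
        ; second = λ where
            refl → w₂ , w₂∈ , (λ e → w₂∉ (there (here e)))
              , fresh (inner w₁∈ w₂∈) (λ where
                  (_ , inj₁ (w₁≡b , _)) → w₁≢b w₁≡b
                  (_ , inj₂ (w₁≡g , _)) → w₁≢g w₁≡g)
              , fresh (first w₂∈ (λ e → w₂∉ (here e))) (λ where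
                  (_ , inj₁ (_ , w₂≡v)) → first∉ w₂∈ w₂≡v
                  (_ , inj₂ (_ , refl)) → w₂∉ (here (home w₂∈)))
        }
      where
      open Threat t
      w₁≢g : w₁ ≢ g
      w₁≢g e = w₁∉ (there (here e))
      w₁≢b : w₁ ≢ b
      w₁≢b refl = w₁∉ (here (home w₁∈))

  -- Walks and Hamilton cycles.

  -- Walk M x ms y: M contains the walk from x to y through the vertices ms.
  data Walk (M : E) : V → List V → V → Set where
    edge : ∀ {x y} → Claimed M x y → Walk M x [] y
    _∷_  : ∀ {x y z ms} → Claimed M x y → Walk M y ms z → Walk M x (y ∷ ms) z

  walk-∷ : ∀ {M e x ms y} → Walk M x ms y → Walk (e ∷ M) x ms y
  walk-∷ (edge c) = edge (claimed-∷ c)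
  walk-∷ (c ∷ w)  = claimed-∷ c ∷ walk-∷ w

  walk-++ : ∀ {M x as y bs z} → Walk M x as y → Walk M y bs z → Walk M x (as ++ y ∷ bs) z
  walk-++ (edge c) w′ = c ∷ w′
  walk-++ (c ∷ w)  w′ = c ∷ walk-++ w w′

  walk-split : ∀ {M x} as {y bs z} → Walk M x (as ++ y ∷ bs) z → Walk M x as y × Walk M y bs z
  walk-split []       (c ∷ w) = edge c , w
  walk-split (a ∷ as) (c ∷ w) with w₁ , w₂ ← walk-split as w = c ∷ w₁ , w₂

  walk-rotate : ∀ {M c} as {d bs} → Walk M c (as ++ d ∷ bs) c → Walk M d (bs ++ c ∷ as) d
  walk-rotate as w with w₁ , w₂ ← walk-split as w = walk-++ w₂ w₁

  unique-suffix : ∀ as {bs : List V} → Unique (as ++ bs) → Unique bs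
  unique-suffix []       u       = u
  unique-suffix (_ ∷ as) (_ ∷ u) = unique-suffix as u

  unique-lookup : ∀ {xs : List V} → Unique xs → ∀ i j → lookup xs i ≡ lookup xs j → i ≡ j
  unique-lookup (_ ∷ _)   zero    zero    _ = refl
  unique-lookup (x≢ ∷ _) zero    (suc j) e = contradiction e (All.lookup x≢ (∈-lookup j))
  unique-lookup (x≢ ∷ _) (suc i) zero    e = contradiction (sym e) (All.lookup x≢ (∈-lookup i))
  unique-lookup (_ ∷ u)  (suc i) (suc j) e = cong suc (unique-lookup u i j e)

  walk-lookup : ∀ {M x ms y} → Walk M x ms y → ∀ i j → toℕ j ≡ suc (toℕ i) →
                Claimed M (lookup (x ∷ ms) i) (lookup (x ∷ ms) j)
  walk-lookup (edge _) zero    zero    ()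
  walk-lookup (c ∷ _)  zero    zero    ()
  walk-lookup (c ∷ _)  zero    (suc zero) _ = c
  walk-lookup (c ∷ _)  zero    (suc (suc _)) ()
  walk-lookup (c ∷ w)  (suc i) (suc j) e = walk-lookup w i j (suc-injective e)
  walk-lookup (c ∷ w)  (suc i) zero ()

  walk-last : ∀ {M x ms y} → Walk M x ms y → ∀ i → suc (toℕ i) ≡ length (x ∷ ms) →
              Claimed M (lookup (x ∷ ms) i) y
  walk-last (edge c) zero    _ = c
  walk-last (_ ∷ _)  zero    ()
  walk-last (_ ∷ w)  (suc i) e = walk-last w i (suc-injective e)

  -- The trailing `[]` is the empty list of missing vertices: a cycle and the vertices it misses are
  -- always given in this form.
  cycle-hamilton : ∀ {M x cs} → Walk M x cs x → x ∷ cs ++ [] ↭ allFin n → HasHamiltonCycle M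
  cycle-hamilton {M} {x} {cs} w cover = f , injective , consecutive , closing
    where
    cover′ : x ∷ cs ↭ allFin n
    cover′ = subst (_↭ allFin n) (++-identityʳ (x ∷ cs)) cover
    len : n ≡ length (x ∷ cs)
    len = sym (trans (↭-length cover′) (length-tabulate id))
    f : V → V
    f i = lookup (x ∷ cs) (cast len i)
    unfold : ∀ {i m} → toℕ i ≡ m → toℕ (cast len i) ≡ m
    unfold {i} e = trans (toℕ-cast len i) e
    injective : ∀ {i j} → f i ≡ f j → i ≡ j
    injective {i} {j} e = toℕ-injective (trans (sym (toℕ-cast len i))
      (trans (cong toℕ (unique-lookup (unique-resp-↭ (↭-sym cover′) (allFin⁺ n)) _ _ e)) (toℕ-cast len j)))
    consecutive : ∀ i j → toℕ j ≡ suc (toℕ i) → Claimed M (f i) (f j)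
    consecutive i j e = walk-lookup w _ _ (unfold (trans e (cong suc (sym (toℕ-cast len i)))))
    closing : ∀ i j → toℕ i ≡ n ∸ 1 → toℕ j ≡ 0 → Claimed M (f i) (f j)
    closing i j i-last j-first = subst (Claimed M (f i)) (sym head) (walk-last w (cast len i) last)
      where
      head : f j ≡ x
      head = cong (lookup (x ∷ cs)) (toℕ-injective {j = zero} (unfold j-first))
      last : suc (toℕ (cast len i)) ≡ length (x ∷ cs)
      last = cong suc (trans (unfold i-last) (cong (_∸ 1) len))

  cover-unique : ∀ {xs : List V} → xs ↭ allFin n → Unique xs
  cover-unique p = unique-resp-↭ (↭-sym p) (allFin⁺ n)

  -- Degree and edge budgets.

  -- A vertex is light, with k moves of WMaker to come, if its degree cannot
  -- exceed L in that time.
  Light : ℕ → ℕ → E → V → Set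
  Light L k B u = degree B u + k ≤ L

  light-step : ∀ {L k M B b g B′ u} → BreakerMove M B b g B′ → Light L (suc k) B u → Light L k B′ u
  light-step {L} {k} {B = B} {u = u} m l =
    ≤-trans (+-monoˡ-≤ k (degree-grows m u)) (≤-trans (≤-reflexive (sym (+-suc (degree B u) k))) l)

  light-degree : ∀ {L k B u} → Light L k B u → degree B u ≤ L
  light-degree {k = k} {B} {u} l = ≤-trans (m≤m+n (degree B u) k) l

  -- WBreaker gains at most one edge per move of WMaker, so under this invariant he never owns more
  -- than `n + 6`; this bounds the number of heavy vertices at every stage.
  Budget : ℕ → E → Set
  Budget k B = length B + k ≤ n + 6

  budget-step : ∀ {k M B b g B′} → BreakerMove M B b g B′ → Budget (suc k) B → Budget k B′
  budget-step {k} {B = B} m l =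
    ≤-trans (+-monoˡ-≤ k (length-grows m)) (≤-trans (≤-reflexive (sym (+-suc (length B) k))) l)

  -- Absorbing the vertices that the cycle misses.

  module Endgame (H L : ℕ) (H+10≤L : H + 10 ≤ L) (few : n + 6 < 50 * suc H)
                 (room : 3 * (3 * suc L + 101) + 3 ≤ n) where

    heavy-bound : ∀ {B : E} {ws} → length B ≤ n + 6 → Unique ws → length (heavy H B ws) ≤ 99
    heavy-bound {B} {ws} B≤ uws = ≤-pred (*-cancelʳ-< (suc H) (length (heavy H B ws)) 100 (begin-strict
      length (heavy H B ws) * suc H ≤⟨ heavy-few H B uws ⟩
      2 * length B                  ≤⟨ *-monoʳ-≤ 2 B≤ ⟩
      2 * (n + 6)                   <⟨ *-monoʳ-< 2 few ⟩
      2 * (50 * suc H)              ≡⟨ sym (*-assoc 2 50 (suc H)) ⟩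
      100 * suc H                   ∎))
      where open ≤-Reasoning

    near : E → List V → List V
    near B []       = []
    near B (t ∷ ts) = t ∷ neighbours B t ++ near B ts

    near-length : ∀ {B} ts → (∀ {t} → t ∈ ts → degree B t ≤ L) → length (near B ts) ≤ length ts * suc L
    near-length []       _ = z≤n
    near-length {B} (t ∷ ts) l = s≤s (≤-trans (≤-reflexive (length-++ (neighbours B t)))
      (+-mono-≤ (l (here refl)) (near-length ts (l ∘ there))))

    near-apart : ∀ {B ts t q} → t ∈ ts → q ∉ near B ts → q ≢ t × ¬ Claimed B t q
    near-apart (here refl) q∉ =
      (λ e → q∉ (here e)) , λ c → q∉ (there (∈-++⁺ˡ (claimed⇒neighbour _ c)))
    near-apart {B} {t ∷ _} (there t∈) q∉ = near-apart t∈ (q∉ ∘ there ∘ ∈-++⁺ʳ (neighbours B t))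

    -- A place z of WMaker's cycle, between a and e, that WBreaker's edges from
    -- her position x and from the missing vertices ts do not touch.
    record Spot (M B : E) (x g : V) (ts : List V) : Set where
      field
        {z e a} : V
        {mid}   : List V
        cycle   : Walk M z (e ∷ mid ++ a ∷ []) z
        cover   : z ∷ (e ∷ mid ++ a ∷ []) ++ ts ↭ allFin n
        apart   : ∀ {q t} → q ∈ z ∷ e ∷ a ∷ [] → t ∈ x ∷ ts → q ≢ t × ¬ Claimed B t q
        off     : ∀ {q} → q ∈ z ∷ e ∷ a ∷ [] → q ≢ g
        light   : ∀ {q} → q ∈ z ∷ e ∷ a ∷ [] → degree B q ≤ H

    -- Abstract, lest the search for a spot be unfolded in the types below.
    abstract
      spot : ∀ {M B x cs ts} g → Walk M x cs x → x ∷ cs ++ ts ↭ allFin n → length ts ≤ 2 →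
             length B ≤ n + 6 → (∀ {t} → t ∈ x ∷ ts → degree B t ≤ L) → Spot M B x g ts
      spot {M} {B} {x} {cs} {ts} g w cover ts≤2 B≤ lights = centre (goodTriple bad cs ucs enough) w cover
        where
        bad : List V
        -- The closed neighbourhoods of `x` and `ts` keep the spot untouched, `g` keeps WBreaker off
        -- it, and the heavy vertices are excluded so that WMaker's next positions are light in
        -- turn.
        bad = near B (x ∷ ts) ++ g ∷ heavy H B (allFin n)
        ucs : Unique cs
        ucs with _ ∷ u ← cover-unique cover = unique-suffix ts (unique-resp-↭ (++-comm cs ts) u)
        bad-length : length bad ≤ 3 * suc L + 100
        bad-length = begin
          length bad ≡⟨ length-++ (near B (x ∷ ts)) ⟩
          length (near B (x ∷ ts)) + suc (length (heavy H B (allFin n)))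
            ≤⟨ +-mono-≤ (≤-trans (near-length {B} (x ∷ ts) lights) (*-monoˡ-≤ (suc L) (s≤s ts≤2)))
                        (s≤s (heavy-bound {B} B≤ (allFin⁺ n))) ⟩
          3 * suc L + 100 ∎
          where open ≤-Reasoning
        -- Three closed neighbourhoods, 99 heavy vertices and `g` bound `bad`; the final 3 accounts
        -- for `x` and the at most two missing vertices, which lie outside `cs`.
        enough : 3 * suc (length bad) ≤ length cs
        enough = +-cancelʳ-≤ 3 _ _ (begin
          3 * suc (length bad) + 3     ≤⟨ +-monoˡ-≤ 3 (*-monoʳ-≤ 3 (s≤s bad-length)) ⟩
          3 * suc (3 * suc L + 100) + 3 ≡⟨ cong (λ l → 3 * l + 3) (sym (+-suc (3 * suc L) 100)) ⟩
          3 * (3 * suc L + 101) + 3    ≤⟨ room ⟩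
          n                            ≡⟨ sym (trans (↭-length cover) (length-tabulate id)) ⟩
          suc (length (cs ++ ts))      ≡⟨ cong suc (length-++ cs) ⟩
          suc (length cs + length ts)  ≤⟨ s≤s (+-monoʳ-≤ (length cs) ts≤2) ⟩
          suc (length cs + 2)          ≡⟨ sym (+-suc (length cs) 2) ⟩
          length cs + 3                ∎)
          where open ≤-Reasoning
        centre : ∀ {cs′} → GoodTriple bad cs′ → Walk M x cs′ x → x ∷ cs′ ++ ts ↭ allFin n → Spot M B x g ts
        centre (as , a , z , e , bs , refl , a∉ , z∉ , e∉) w′ cover′ = record
          { cycle = walk-rotate [] (walk-rotate as w′)
          ; cover = ↭-trans (++⁺ʳ ts (↭-trans (++-comm (z ∷ e ∷ bs ++ x ∷ as) (a ∷ []))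
                                              (++-comm (a ∷ z ∷ e ∷ bs) (x ∷ as)))) cover′
          ; apart = λ q∈ t∈ → near-apart {B} t∈ (bad∌ q∈ ∘ ∈-++⁺ˡ)
          ; off   = λ q∈ q≡g → bad∌ q∈ (∈-++⁺ʳ (near B (x ∷ ts)) (here q≡g))
          ; light = λ {q} q∈ → ≮⇒≥ λ H<q → bad∌ q∈ (∈-++⁺ʳ (near B (x ∷ ts))
                      (there (∈-filter⁺ (λ u → H <? degree B u) (∈-allFin q) H<q)))
          }
          where
          bad∌ : ∀ {q} → q ∈ z ∷ e ∷ a ∷ [] → q ∉ bad
          bad∌ (here refl)                 = z∉
          bad∌ (there (here refl))         = e∉
          bad∌ (there (there (here refl))) = a∉

    -- WMaker, at z on her cycle, absorbs u: WBreaker can block only one of the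
    -- two edges ue and ua.
    insert : ∀ {k M B z e mid a g u ts} →
      Walk M z (e ∷ mid ++ a ∷ []) z → z ∷ (e ∷ mid ++ a ∷ []) ++ u ∷ ts ↭ allFin n →
      (∀ {q} → q ∈ z ∷ e ∷ a ∷ [] → q ≢ u × ¬ Claimed B u q) →
      (∀ {q cs M′ g′ B′} → q ∈ e ∷ a ∷ [] → BreakerMove ((z , u) ∷ M) B g g′ B′ →
        Walk M′ q cs q → q ∷ cs ++ ts ↭ allFin n →
        HasHamiltonCycle M′ ⊎ Wins k M′ B′ q g′) →
      Replies (suc k) M B z g
    insert {k} {M} {B} {z} {e} {mid} {a} {g} {u} {ts} w cover apart next =
      makerStep (proj₁ (apart (here refl))) (proj₂ (apart (here refl)) ∘ claimed-sym)
        (inj₂ (breakerTurn reply))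
      where
      e≢a : e ≢ a
      e≢a refl with _ ∷ e≢ ∷ _ ← cover-unique cover =
        All.lookup e≢ (∈-++⁺ˡ (∈-++⁺ʳ mid (here refl))) refl
      cover-e : e ∷ ((mid ++ a ∷ []) ++ z ∷ u ∷ []) ++ ts ↭ allFin n
      cover-e = ↭-trans (++⁺ʳ ts (++-comm (e ∷ mid ++ a ∷ []) (z ∷ u ∷ [])))
        (↭-trans (prep z (↭-sym (shift u (e ∷ mid ++ a ∷ []) ts))) cover)
      cover-a : a ∷ (u ∷ z ∷ e ∷ mid) ++ ts ↭ allFin n
      cover-a = ↭-trans (++⁺ʳ ts (++-comm (a ∷ u ∷ []) (z ∷ e ∷ mid)))
        (↭-trans (↭-reflexive (cong (z ∷_) (cong (e ∷_) (++-assoc mid (a ∷ u ∷ []) ts))))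
          (↭-trans (↭-reflexive (cong (z ∷_) (cong (e ∷_) (sym (++-assoc mid (a ∷ []) (u ∷ ts)))))) cover))
      reply : ∀ {g′ B′} → BreakerMove ((z , u) ∷ M) B g g′ B′ →
              Replies k ((z , u) ∷ M) B′ u g′
      reply {g′} {B′} m with claimed? B′ u e
      ... | no u≁e = makerStep (≢-sym (proj₁ (apart (there (here refl))))) u≁e
        (next (here refl) m (walk-rotate (u ∷ []) (zu ∷ ue ∷ proj₂ (walk-split [] (walk-∷ (walk-∷ w))))) cover-e)
        where
        zu : Claimed ((u , e) ∷ (z , u) ∷ M) z u
        zu = inj₁ (there (here refl))
        ue : Claimed ((u , e) ∷ (z , u) ∷ M) u e
        ue = inj₁ (here refl)
      ... | yes u∼e = makerStep (≢-sym (proj₁ (apart (there (there (here refl)))))) u≁a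
        (next (there (here refl)) m
          (walk-rotate (e ∷ mid) (walk-++ (proj₁ (walk-split (e ∷ mid) (walk-∷ (walk-∷ w)))) (au ∷ edge uz))) cover-a)
        where
        au : Claimed ((u , a) ∷ (z , u) ∷ M) a u
        au = inj₂ (here refl)
        uz : Claimed ((u , a) ∷ (z , u) ∷ M) u z
        uz = inj₂ (there (here refl))
        -- If both `ue` and `ua` were new they would be the same edge, so `e` and `a` would coincide
        -- or WBreaker's move would be a loop.
        u≁a : ¬ Claimed B′ u a
        u≁a u∼a with extends m u∼e | extends m u∼a
        ... | inj₁ o | _ = proj₂ (apart (there (here refl))) o
        ... | inj₂ _ | inj₁ o = proj₂ (apart (there (there (here refl)))) o
        ... | inj₂ (_ , inj₁ (_ , refl)) | inj₂ (_ , inj₁ (_ , refl)) = e≢a refl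
        ... | inj₂ (_ , inj₂ (_ , refl)) | inj₂ (_ , inj₂ (_ , refl)) = e≢a refl
        ... | inj₂ (b≢g , inj₁ (refl , _)) | inj₂ (_ , inj₂ (refl , _)) = b≢g refl
        ... | inj₂ (b≢g , inj₂ (refl , _)) | inj₂ (_ , inj₁ (refl , _)) = b≢g refl

    -- If WBreaker guards the last vertex t, his block takes him away from t, and
    -- he cannot repeat it after her second jump.
    lastVertex : ∀ {M B x b cs t} → Walk M x cs x → x ∷ cs ++ t ∷ [] ↭ allFin n →
      (∀ {u} → u ∈ x ∷ t ∷ [] → Light L 4 B u) → Budget 4 B →
      Wins 4 M B x b
    lastVertex {M} {B} {x} {b} {cs} {t} w cover lights budget = breakerTurn first-jump
      where
      first-jump : ∀ {g B′} → BreakerMove M B b g B′ → Replies 3 M B′ x g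
      first-jump {g} {B′} m = makerStep (≢-sym (proj₁ (S.apart (here refl) (here refl))))
          (proj₂ (S.apart (here refl) (here refl))) (inj₂ (breakerTurn second))
        where
        budget′ : Budget 3 B′
        budget′ = budget-step m budget
        s : Spot M B′ x g (t ∷ [])
        s = spot g w cover (s≤s z≤n) (≤-trans (m≤m+n (length B′) 3) budget′)
          (λ u∈ → light-degree {k = 3} {B = B′} (light-step m (lights u∈)))
        module S = Spot s
        M₁ : E
        M₁ = (x , S.z) ∷ M
        second : ∀ {g₂ B₂} → BreakerMove M₁ B′ g g₂ B₂ → Replies 2 M₁ B₂ S.z g₂
        second {g₂} {B₂} m₂ with claimed? B₂ t S.z ⊎-dec (claimed? B₂ t S.e ⊎-dec claimed? B₂ t S.a)
        ... | no untouched = insert (walk-∷ S.cycle) S.cover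
            (λ q∈ → proj₁ (S.apart q∈ (there (here refl))) , clear q∈)
            (λ _ _ w′ c′ → inj₁ (cycle-hamilton w′ c′))
          where
          clear : ∀ {q} → q ∈ S.z ∷ S.e ∷ S.a ∷ [] → ¬ Claimed B₂ t q
          clear (here refl)                 c = untouched (inj₁ c)
          clear (there (here refl))         c = untouched (inj₂ (inj₁ c))
          clear (there (there (here refl))) c = untouched (inj₂ (inj₂ c))
        ... | yes touched = makerStep (≢-sym (proj₁ (S₂.apart (here refl) (here refl))))
            (proj₂ (S₂.apart (here refl) (here refl))) (inj₂ (breakerTurn third))
          where
          budget₂ : Budget 2 B₂
          budget₂ = budget-step m₂ budget′
          s₂ : Spot M₁ B₂ S.z g₂ (t ∷ [])
          s₂ = spot g₂ (walk-∷ S.cycle) S.cover (s≤s z≤n) (≤-trans (m≤m+n (length B₂) 2) budget₂)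
            -- `S.z` had degree at most `H` when it was chosen and has gained at most one since.
            (λ where
              (here refl) → ≤-trans (degree-grows m₂ S.z)
                (≤-trans (s≤s (S.light (here refl))) (≤-trans (≤-reflexive (+-comm 1 H))
                  (≤-trans (+-monoʳ-≤ H (s≤s z≤n)) H+10≤L)))
              (there (here refl)) → light-degree {k = 2} {B = B₂}
                (light-step m₂ (light-step m (lights (there (here refl))))))
          module S₂ = Spot s₂
          M₂ : E
          M₂ = (S.z , S₂.z) ∷ M₁
          -- The edge from `t` to the spot is new, and WBreaker did not stand on the spot, so he
          -- walked it away from `t`.
          left-t : ∀ {q} → q ∈ S.z ∷ S.e ∷ S.a ∷ [] → Claimed B₂ t q → g₂ ≢ t
          left-t q∈ c g₂≡t with extends m₂ c
          ... | inj₁ o = proj₂ (S.apart q∈ (there (here refl))) o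
          ... | inj₂ (_ , inj₁ (_ , q≡g₂)) = proj₁ (S.apart q∈ (there (here refl))) (trans q≡g₂ g₂≡t)
          ... | inj₂ (_ , inj₂ (_ , q≡g)) = S.off q∈ q≡g
          g₂≢t : g₂ ≢ t
          g₂≢t = [ left-t (here refl) , [ left-t (there (here refl)) , left-t (there (there (here refl))) ]′ ]′ touched
          third : ∀ {g₃ B₃} → BreakerMove M₂ B₂ g₂ g₃ B₃ → Replies 1 M₂ B₃ S₂.z g₃
          third {g₃} {B₃} m₃ = insert (walk-∷ S₂.cycle) S₂.cover
              (λ q∈ → proj₁ (S₂.apart q∈ (there (here refl))) , clear q∈)
              (λ _ _ w′ c′ → inj₁ (cycle-hamilton w′ c′))
            where
            clear : ∀ {q} → q ∈ S₂.z ∷ S₂.e ∷ S₂.a ∷ [] → ¬ Claimed B₃ t q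
            clear q∈ c with extends m₃ c
            ... | inj₁ o = proj₂ (S₂.apart q∈ (there (here refl))) o
            ... | inj₂ (_ , inj₁ (t≡g₂ , _)) = g₂≢t (sym t≡g₂)
            ... | inj₂ (_ , inj₂ (_ , q≡g₂)) = S₂.off q∈ q≡g₂

    -- One chord suffices before the first insertion: an edge meeting both `t₁` and `t₂` misses the
    -- spot, so WBreaker cannot spoil it for both. Seven moves: the chord, two for the insertion,
    -- four for the last vertex.
    twoVertices : ∀ {M B x b cs t₁ t₂} → Walk M x cs x → x ∷ cs ++ t₁ ∷ t₂ ∷ [] ↭ allFin n →
      (∀ {u} → u ∈ x ∷ t₁ ∷ t₂ ∷ [] → Light L 7 B u) → Budget 7 B →
      Wins 7 M B x b
    twoVertices {M} {B} {x} {b} {cs} {t₁} {t₂} w cover lights budget = breakerTurn jump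
      where
      t₁≢t₂ : t₁ ≢ t₂
      t₁≢t₂ refl with (t≢ ∷ _) ← unique-suffix (x ∷ cs) (cover-unique cover) = All.lookup t≢ (here refl) refl
      jump : ∀ {g B′} → BreakerMove M B b g B′ → Replies 6 M B′ x g
      jump {g} {B′} m = makerStep (≢-sym (proj₁ (S.apart (here refl) (here refl))))
          (proj₂ (S.apart (here refl) (here refl))) (inj₂ (breakerTurn second))
        where
        budget′ : Budget 6 B′
        budget′ = budget-step m budget
        s : Spot M B′ x g (t₁ ∷ t₂ ∷ [])
        s = spot g w cover ≤-refl (≤-trans (m≤m+n (length B′) 6) budget′)
          (λ u∈ → light-degree {k = 6} {B = B′} (light-step m (lights u∈)))
        module S = Spot s
        M₁ : E
        M₁ = (x , S.z) ∷ M
        second : ∀ {g₂ B₂} → BreakerMove M₁ B′ g g₂ B₂ → Replies 5 M₁ B₂ S.z g₂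
        second {g₂} {B₂} m₂ = pick (claimed? B₂ t₁ S.z ⊎-dec (claimed? B₂ t₁ S.e ⊎-dec claimed? B₂ t₁ S.a))
          where
          absorb : ∀ {t t′} → t ∈ t₁ ∷ t₂ ∷ [] → t′ ∈ t₁ ∷ t₂ ∷ [] → t₁ ∷ t₂ ∷ [] ↭ t ∷ t′ ∷ [] →
                   (∀ {q} → q ∈ S.z ∷ S.e ∷ S.a ∷ [] → ¬ Claimed B₂ t q) →
                   Replies 5 M₁ B₂ S.z g₂
          absorb t∈ t′∈ p clear = insert (walk-∷ S.cycle)
            (↭-trans (++⁺ˡ (S.z ∷ S.e ∷ S.mid ++ S.a ∷ []) (↭-sym p)) S.cover)
            (λ q∈ → proj₁ (S.apart q∈ (there t∈)) , clear q∈)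
            (λ q∈ m₃ w′ c′ → inj₂ (lastVertex w′ c′
              (λ where
                -- `q` had degree at most `H` with six moves to come, and `H + 6` is within `L`.
                (here refl) → light-step m₃ (light-step m₂
                  (≤-trans (+-mono-≤ (S.light (there q∈)) (≤ᵇ⇒≤ 6 10 _)) H+10≤L))
                (there (here refl)) → light-step m₃ (light-step m₂ (light-step m (lights (there t′∈)))))
              (budget-step m₃ (budget-step m₂ budget′))))
          pick : Dec (Claimed B₂ t₁ S.z ⊎ (Claimed B₂ t₁ S.e ⊎ Claimed B₂ t₁ S.a)) →
                 Replies 5 M₁ B₂ S.z g₂
          pick (no untouched) = absorb (here refl) (there (here refl)) ↭-refl λ where
            (here refl)                 c → untouched (inj₁ c)
            (there (here refl))         c → untouched (inj₂ (inj₁ c))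
            (there (there (here refl))) c → untouched (inj₂ (inj₂ c))
          pick (yes touched) = absorb (there (here refl)) (here refl) (swap t₁ t₂ ↭-refl)
              (λ q∈ → [ other (here refl) q∈ , [ other (there (here refl)) q∈
                      , other (there (there (here refl))) q∈ ]′ ]′ touched)
            where
            other : ∀ {p q} → p ∈ S.z ∷ S.e ∷ S.a ∷ [] → q ∈ S.z ∷ S.e ∷ S.a ∷ [] →
                    Claimed B₂ t₁ p → ¬ Claimed B₂ t₂ q
            other p∈ q∈ c₁ c₂ with extends m₂ c₁ | extends m₂ c₂
            ... | inj₁ o | _ = proj₂ (S.apart p∈ (there (here refl))) o
            ... | inj₂ _ | inj₁ o = proj₂ (S.apart q∈ (there (there (here refl)))) o
            ... | inj₂ (_ , inj₁ (t₁≡g , _)) | inj₂ (_ , inj₁ (t₂≡g , _)) = t₁≢t₂ (trans t₁≡g (sym t₂≡g))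
            ... | inj₂ (_ , inj₂ (t₁≡g₂ , _)) | inj₂ (_ , inj₂ (t₂≡g₂ , _)) = t₁≢t₂ (trans t₁≡g₂ (sym t₂≡g₂))
            ... | inj₂ (_ , inj₁ (t₁≡g , _)) | inj₂ (_ , inj₂ (_ , q≡g)) =
              proj₁ (S.apart q∈ (there (here refl))) (trans q≡g (sym t₁≡g))
            ... | inj₂ (_ , inj₂ (_ , p≡g)) | inj₂ (_ , inj₁ (t₂≡g , _)) =
              proj₁ (S.apart p∈ (there (there (here refl)))) (trans p≡g (sym t₂≡g))

    -- After closing the cycle at v WMaker steps back to w, whose degree is under control.
    closeCycle : ∀ {k M B w ms v g U} → w ≢ v → ¬ Claimed B w v →
      Walk M w ms v → w ∷ ms ++ v ∷ U ↭ allFin n →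
      (∀ {M′ M″ g′ B′} → BreakerMove M′ B g g′ B′ → Walk M″ w (ms ++ v ∷ []) w →
        w ∷ (ms ++ v ∷ []) ++ U ↭ allFin n → Wins k M″ B′ w g′) →
      Replies (suc k) M B w g
    closeCycle {k} {ms = ms} {v} {U = U} w≢v b∌ walk cover next = makerStep w≢v b∌
      (inj₂ (breakerTurn λ m →
        makerStep (≢-sym w≢v) (keepsOff m (inj₁ (here refl)) b∌ ∘ claimed-sym)
          (inj₂ (next m (walk-++ (walk-∷ (walk-∷ walk)) (edge (inj₁ (here refl))))
            (↭-trans (↭-reflexive (cong (_ ∷_) (++-assoc ms (v ∷ []) U))) cover)))))

    -- Building the path and visiting the heavy vertices.

    -- A path missing j vertices cost n - j - 1 moves out of n + 6, so j + 7 remain.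
    record OnPath (j : ℕ) (M B : E) (x b v : V) (U : List V) : Set where
      field
        {ms}   : List V
        walk   : Walk M x ms v
        cover  : x ∷ ms ++ v ∷ U ↭ allFin n
        size   : length U ≡ j
        budget : Budget (j + 7) B

      frame : Frame x v U
      frame with x≢ ∷ uU ← cover-unique cover = record
        { unique = unique-suffix (v ∷ []) uvU
        ; x∉U    = λ x∈ → All.lookup x≢ (∈-++⁺ʳ ms (there x∈)) refl
        ; v∉U    = v∉ uvU
        ; x≢v    = All.lookup x≢ (∈-++⁺ʳ ms (here refl))
        }
        where
        uvU : Unique (v ∷ U)
        uvU = unique-suffix ms uU
        v∉ : Unique (v ∷ U) → v ∉ U
        v∉ (v≢ ∷ _) v∈ = All.lookup v≢ v∈ refl

    open OnPath

    extend : ∀ {j M B B′ x b g v U y U′} → OnPath (suc j) M B x b v U → BreakerMove M B b g B′ →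
             U ↭ y ∷ U′ → OnPath j ((x , y) ∷ M) B′ y g v U′
    extend {x = x} {v = v} {y = y} {U′} p m U↭ = record
      { walk   = inj₂ (here refl) ∷ walk-∷ (walk p)
      ; cover  = ↭-trans (↭-sym (↭-trans (++⁺ˡ (x ∷ ms p) (↭-trans (prep v U↭) (swap v y ↭-refl)))
                                         (shift y (x ∷ ms p) (v ∷ U′)))) (cover p)
      ; size   = suc-injective (trans (sym (↭-length U↭)) (size p))
      ; budget = budget-step m (budget p)
      }

    -- Ten moves: one to `w₁`, two for closing and stepping back, seven for the two missing
    -- vertices. The detour through `w₂` costs one more, but then a single vertex is missing and
    -- four moves suffice for it.
    close : ∀ {M B x b v U} → OnPath 3 M B x b v U → Sound B x v b U →
            (∀ {u} → u ∈ U → Light L 10 B u) → Wins 10 M B x b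
    close {M} {B} {x} {b} {v} {U} p sound lights = breakerTurn choose
      where
      open Frame (frame p) using (unique; v∉U)
      ≢v : ∀ {u} → u ∈ U → u ≢ v
      ≢v u∈ refl = v∉U u∈
      ≢x : ∀ {u} → u ∈ U → x ≢ u
      ≢x u∈ refl = Frame.x∉U (frame p) u∈
      choose : ∀ {g B′} → BreakerMove M B b g B′ → Replies 9 M B′ x g
      choose {g} {B′} m
        with U′ , U↭ ← extract (Closers.w₁∈ (closers (frame p) (extends m) (≤-reflexive (sym (size p))) sound))
        = makerStep (≢x w₁∈) x≁w₁ (inj₂ (breakerTurn first-try))
        where
        open Closers (closers (frame p) (extends m) (≤-reflexive (sym (size p))) sound)
        p₁ : OnPath 2 ((x , w₁) ∷ M) B′ w₁ g v U′
        p₁ = extend p m U↭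
        r₁ : Removed U w₁ U′
        r₁ = removed unique U↭
        first-try : ∀ {g₂ B₂} → BreakerMove ((x , w₁) ∷ M) B′ g g₂ B₂ → Replies 8 ((x , w₁) ∷ M) B₂ w₁ g₂
        first-try {g₂} {B₂} m₂ with claimed? B₂ w₁ v
        ... | no w₁≁v = closeCycle (≢v w₁∈) w₁≁v (walk p₁) (cover p₁) (finish U′ (size p₁) (λ u∈ → Removed.sub r₁ u∈))
          where
          finish : ∀ W → length W ≡ 2 → (∀ {u} → u ∈ W → u ∈ U) →
                   ∀ {M₁ M₂ g₃ B₃ cs} → BreakerMove M₁ B₂ g₂ g₃ B₃ → Walk M₂ w₁ cs w₁ →
                   w₁ ∷ cs ++ W ↭ allFin n → Wins 7 M₂ B₃ w₁ g₃
          finish (t₁ ∷ t₂ ∷ []) refl sub m₃ cycle cov = twoVertices cycle cov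
            (λ where
              (here refl) → light-step m₃ (light-step m₂ (light-step m (lights w₁∈)))
              (there u∈)  → light-step m₃ (light-step m₂ (light-step m (lights (sub u∈)))))
            (budget-step m₃ (budget-step m₂ (budget p₁)))
        ... | yes w₁∼v = second-try (second g≡v)
          where
          w₁v : Joins g g₂ w₁ v
          w₁v = [ (λ o → contradiction (claimed-sym o) v≁w₁) , id ]′ (extends m₂ w₁∼v)
          g≡v : g ≡ v
          g≡v with proj₂ w₁v
          ... | inj₁ (w₁≡g , _) = contradiction (sym w₁≡g) g≢w₁
          ... | inj₂ (_ , v≡g)  = sym v≡g
          g₂≡w₁ : g₂ ≡ w₁
          g₂≡w₁ with proj₂ w₁v
          ... | inj₁ (w₁≡g , _)  = contradiction (sym w₁≡g) g≢w₁
          ... | inj₂ (w₁≡g₂ , _) = sym w₁≡g₂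
          second-try : ∃[ w₂ ] (w₂ ∈ U × w₂ ≢ w₁ × ¬ Claimed B′ w₁ w₂ × ¬ Claimed B′ v w₂) →
                       Replies 8 ((x , w₁) ∷ M) B₂ w₁ g₂
          second-try (w₂ , w₂∈ , w₂≢w₁ , w₁≁w₂ , v≁w₂) with U″ , U′↭ ← extract (Removed.back r₁ w₂∈ w₂≢w₁) =
            makerStep (≢-sym w₂≢w₁) w₁≁₂w₂ (inj₂ (breakerTurn last-try))
            where
            apart : ∀ {s} → s ∈ U → s ≢ w₁ → ∀ {t} → ¬ Joins g g₂ s t
            apart s∈ s≢w₁ (_ , inj₁ (s≡g , _))  = ≢v s∈ (trans s≡g g≡v)
            apart s∈ s≢w₁ (_ , inj₂ (s≡g₂ , _)) = s≢w₁ (trans s≡g₂ g₂≡w₁)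
            w₁≁₂w₂ : ¬ Claimed B₂ w₁ w₂
            w₁≁₂w₂ c = [ w₁≁w₂ ∘ claimed-sym , apart w₂∈ w₂≢w₁ ]′ (extends m₂ (claimed-sym c))
            p₂ : OnPath 1 ((w₁ , w₂) ∷ (x , w₁) ∷ M) B₂ w₂ g₂ v U″
            p₂ = extend p₁ m₂ U′↭
            r₂ : Removed U′ w₂ U″
            r₂ = removed (Frame.unique (frame p₁)) U′↭
            finish : ∀ {B₃ g₃} → BreakerMove ((w₁ , w₂) ∷ (x , w₁) ∷ M) B₂ g₂ g₃ B₃ →
                     ∀ W → length W ≡ 1 → (∀ {u} → u ∈ W → u ∈ U) →
                     ∀ {M₁ M₂ g₄ B₄ cs} → BreakerMove M₁ B₃ g₃ g₄ B₄ → Walk M₂ w₂ cs w₂ →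
                     w₂ ∷ cs ++ W ↭ allFin n → Wins 6 M₂ B₄ w₂ g₄
            finish m₃ (t ∷ []) refl sub {B₄ = B₄} m₄ cycle cov = wins-mono (≤ᵇ⇒≤ 4 6 _) (lastVertex cycle cov lights₄
              (≤-trans (+-monoʳ-≤ _ (≤ᵇ⇒≤ 4 6 _)) (budget-step m₄ (budget-step m₃ (budget p₂)))))
              where
              relax : ∀ {u} → u ∈ U → Light L 4 B₄ u
              relax {u} u∈ = ≤-trans (+-monoʳ-≤ (degree B₄ u) (≤ᵇ⇒≤ 4 6 _))
                (light-step m₄ (light-step m₃ (light-step m₂ (light-step m (lights u∈)))))
              lights₄ : ∀ {u} → u ∈ w₂ ∷ t ∷ [] → Light L 4 B₄ u
              lights₄ (here refl) = relax w₂∈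
              lights₄ (there u∈)  = relax (sub u∈)
            last-try : ∀ {g₃ B₃} → BreakerMove ((w₁ , w₂) ∷ (x , w₁) ∷ M) B₂ g₂ g₃ B₃ →
                       Replies 7 ((w₁ , w₂) ∷ (x , w₁) ∷ M) B₃ w₂ g₃
            last-try {g₃} {B₃} m₃ = closeCycle (≢v w₂∈) w₂≁v (walk p₂) (cover p₂)
              (finish m₃ U″ (size p₂) (λ u∈ → Removed.sub r₁ (Removed.sub r₂ u∈)))
              where
              w₂≁v : ¬ Claimed B₃ w₂ v
              w₂≁v c with extends m₃ c
              ... | inj₁ o = [ v≁w₂ ∘ claimed-sym , apart w₂∈ w₂≢w₁ ]′ (extends m₂ o)
              ... | inj₂ (_ , inj₁ (w₂≡g₂ , _)) = w₂≢w₁ (trans w₂≡g₂ g₂≡w₁)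
              ... | inj₂ (_ , inj₂ (_ , v≡g₂)) = ≢v w₁∈ (sym (trans v≡g₂ g₂≡w₁))

    -- Passing this implication to the continuations spares them from tracking how `B′` arose from
    -- `B` on the way from `j` to `j′` missing vertices.
    Lights : ℕ → E → ℕ → E → Set
    Lights j B j′ B′ = ∀ {u} → Light L (j + 7) B u → Light L (j′ + 7) B′ u

    huntMove : ∀ {j k M B x b v U o} → OnPath (suc j) M B x b v U → 3 ≤ j → o ∈ U → Hunt B x v o b U k →
      (∀ {M′ B′ y g U′} → OnPath j M′ B′ y g v U′ → Removed U y U′ → Lights (suc j) B j B′ →
        (y ≡ o × Sound B′ y v g U′) ⊎ (y ≢ o × ∃[ l ] (l < k × Hunt B′ y v o g U′ l)) → Wins (j + 7) M′ B′ y g) →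
      Wins (suc j + 7) M B x b
    huntMove {j} {k} {M} {B} {x} {b} {v} {U} {o} p 3≤j o∈ h next = breakerTurn reply
      where
      reply : ∀ {g B′} → BreakerMove M B b g B′ → Replies (j + 7) M B′ x g
      reply {g} {B′} m = answer (huntStep o∈ (≤-trans (s≤s 3≤j) (≤-reflexive (sym (size p)))) h)
        where
        open Step (frame p) (extends m)
        answer : Choice (Outcome o∈ k) → Replies (j + 7) M B′ x g
        answer (y , y∈ , x≁y , out) with U′ , U↭ ← extract y∈ =
          makerStep (λ { refl → Frame.x∉U (frame p) y∈ }) x≁y
            (inj₂ (next (extend p m U↭) rm (light-step m) (result (out rm))))
          where
          rm : Removed U y U′
          rm = removed (Frame.unique (frame p)) U↭
          result : Outcome o∈ k y U′ →
                   (y ≡ o × Sound B′ y v g U′) ⊎ (y ≢ o × ∃[ l ] (l < k × Hunt B′ y v o g U′ l))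
          result (caught y≡o s)      = inj₁ (y≡o , s)
          result (hunting y≢o l<k h′) = inj₂ (y≢o , _ , l<k , h′)

    -- The bound `3 + k ≤ j` leaves at least four unvisited vertices before every move of the hunt,
    -- as `huntStep` requires.
    hunt : ∀ k {l j M B x b v U o} → l ≤ k → 3 + k ≤ j → OnPath j M B x b v U → o ∈ U → Hunt B x v o b U l →
      (∀ {j′ M′ B′ y g U′} → OnPath j′ M′ B′ y g v U′ → Sound B′ y v g U′ → j ≤ j′ + k →
        (∀ {u} → u ∈ U′ → u ∈ U) → o ∉ U′ → Lights j B j′ B′ → Wins (j′ + 7) M′ B′ y g) →
      Wins (j + 7) M B x b
    hunt zero    z≤n _ _ _ ()
    hunt (suc k) {j = suc j} l≤k (s≤s k≤j) p o∈ h next =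
      huntMove p (≤-trans (s≤s (s≤s (s≤s z≤n))) k≤j) o∈ h λ where
        p′ rm ls (inj₁ (refl , s)) →
          next p′ s (≤-trans (s≤s (m≤m+n j k)) (≤-reflexive (sym (+-suc j k)))) (Removed.sub rm) (Removed.gone rm) ls
        p′ rm ls (inj₂ (y≢o , _ , l<l , h′)) →
          hunt k (≤-pred (≤-trans l<l l≤k)) (≤-trans (s≤s (s≤s (s≤s ≤-refl))) k≤j) p′
            (Removed.back rm o∈ (≢-sym y≢o)) h′
            λ {j′} p″ s j≤ sub o∉ ls′ → next p″ s (≤-trans (s≤s j≤) (≤-reflexive (sym (+-suc j′ k))))
              (Removed.sub rm ∘ sub) o∉ (λ l → ls′ (ls l))

    some-target : ∀ {j M B x b v U} → OnPath (suc j) M B x b v U → ∃[ o ] o ∈ U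
    some-target {U = []}    p with () ← size p
    some-target {U = o ∷ _} p = o , here refl

    -- Soundness is kept by playing a single move of a hunt for an arbitrary vertex.
    oneMove : ∀ {j M B x b v U} → OnPath (suc j) M B x b v U → Sound B x v b U → 3 ≤ j →
      (∀ {M′ B′ y g U′} → OnPath j M′ B′ y g v U′ → Sound B′ y v g U′ → (∀ {u} → u ∈ U′ → u ∈ U) →
        Lights (suc j) B j B′ → Wins (j + 7) M′ B′ y g) →
      Wins (suc j + 7) M B x b
    oneMove p s 3≤j next with o , o∈ ← some-target p with _ , _ , h ← sound-hunt (frame p) o∈ s =
      huntMove p 3≤j o∈ h λ where
        p′ rm ls (inj₁ (_ , s′))         → next p′ s′ (Removed.sub rm) ls
        p′ rm ls (inj₂ (_ , _ , _ , h′)) → next p′ (hunt-sound h′) (Removed.sub rm) ls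

    descend : ∀ i {M B x b v U} → OnPath (i + 3) M B x b v U → Sound B x v b U →
              (∀ {u} → u ∈ U → Light L (i + 3 + 7) B u) → Wins (i + 3 + 7) M B x b
    descend zero    p s lights = close p s lights
    descend (suc i) p s lights = oneMove p s (m≤n+m 3 i) λ p′ s′ sub ls →
      descend i p′ s′ (λ u∈ → ls (lights (sub u∈)))

    ≤⇒∃+ : ∀ {k j} → k ≤ j → ∃[ i ] j ≡ i + k
    ≤⇒∃+ {k} {j} k≤j = j ∸ k , sym (m∸n+n≡m k≤j)

    -- `O` lists the vertices that may fail to be light. Each is already visited or is caught within
    -- ten moves, which the bound on `j` pays for.
    clearHeavy : ∀ O {j M B x b v U} → length O * 10 + 3 ≤ j → OnPath j M B x b v U → Sound B x v b U →
                 (∀ {u} → u ∈ U → u ∉ O → Light L (j + 7) B u) → Wins (j + 7) M B x b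
    clearHeavy [] {j} 3≤j p s lights with i , refl ← ≤⇒∃+ 3≤j = descend i p s (λ u∈ → lights u∈ λ ())
    clearHeavy (o ∷ O) {j} {U = U} room′ p s lights with o ∈? U
    ... | no o∉ = clearHeavy O (≤-trans (m≤n+m _ 10) room′) p s λ where
            u∈ u∉ → lights u∈ λ { (here refl) → o∉ u∈ ; (there u∈O) → u∉ u∈O }
    ... | yes o∈ with _ , k≤10 , h ← sound-hunt (frame p) o∈ s =
      hunt 10 k≤10 (≤-trans (+-monoʳ-≤ 10 (m≤n+m 3 (length O * 10))) room′) p o∈ h
        λ {j′} p′ s′ j≤ sub o∉ ls → clearHeavy O
          (+-cancelˡ-≤ 10 _ _ (≤-trans room′ (≤-trans j≤ (≤-reflexive (+-comm j′ 10))))) p′ s′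
          λ u∈ u∉ → ls (lights (sub u∈) λ { (here refl) → o∉ u∈ ; (there u∈O) → u∉ u∈O })

    -- 993 = 99 · 10 + 3: ten moves for each heavy vertex, and three vertices for close.
    module Opening (K : ℕ) (993≤K : 993 ≤ K) (H+K≤L : H + (K + 7) ≤ L) where

      -- The heavy vertices are determined only when `K` vertices are left: the `K + 7` moves to
      -- come then raise any degree of at most `H` to at most `L`.
      descendTo : ∀ i {M B x b v U} → OnPath (i + K) M B x b v U → Sound B x v b U → Wins (i + K + 7) M B x b
      descendTo zero {B = B} {U = U} p s = clearHeavy (heavy H B U)
        (≤-trans (+-monoˡ-≤ 3 (*-monoˡ-≤ 10 (heavy-bound {B} B≤ (Frame.unique (frame p))))) 993≤K) p s
        λ {u} u∈ u∉ → ≤-trans (+-monoˡ-≤ (K + 7) (≮⇒≥ λ H<u → u∉ (∈-filter⁺ (λ w → H <? degree B w) u∈ H<u))) H+K≤L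
        where
        B≤ : length B ≤ n + 6
        B≤ = ≤-trans (m≤m+n (length B) (K + 7)) (budget p)
      descendTo (suc i) p s = oneMove p s (≤-trans (≤-trans (≤ᵇ⇒≤ 3 993 _) 993≤K) (m≤n+m K i))
        λ p′ s′ _ _ → descendTo i p′ s′

      opening : ∀ {j M B x b v U} → K ≤ j → OnPath j M B x b v U → Sound B x v b U → Wins (j + 7) M B x b
      opening K≤j p s with i , refl ← ≤⇒∃+ K≤j = descendTo i p s

-- Choice of constants and the first move.

module _ (j : ℕ) where

  private
    n H K L : ℕ
    n = suc (suc j)
    H = (n + 6) / 50
    K = 993
    L = H + (K + 7)

    quotient-≤ : H * 50 ≤ n + 6
    quotient-≤ = m/n*n≤m (n + 6) 50

    quotient-< : n + 6 < 50 * suc H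
    quotient-< = begin-strict
      n + 6                   ≡⟨ m≡m%n+[m/n]*n (n + 6) 50 ⟩
      (n + 6) % 50 + H * 50   <⟨ +-monoˡ-< (H * 50) (m%n<n (n + 6) 50) ⟩
      suc H * 50              ≡⟨ *-comm (suc H) 50 ⟩
      50 * suc H              ∎
      where open ≤-Reasoning

    expand : ∀ h c → 2 * (3 * (3 * suc (h + c) + 101) + 3) ≡ h * 18 + (18 * c + 630)
    expand = solve-∀

    double : ∀ m → m + m ≡ 2 * m
    double = solve-∀

    slack : H + 10 ≤ L
    slack = +-monoʳ-≤ H (≤ᵇ⇒≤ 10 (K + 7) _)

    room : 20000 ≤ n → 3 * (3 * suc L + 101) + 3 ≤ n
    -- After doubling, `H` has coefficient 18, and `18 * H` is at most `50 * H`, hence at most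
    -- `n + 6`; the second copy of `n` absorbs the constants.
    room n₀≤n = *-cancelˡ-≤ 2 (begin
      2 * (3 * (3 * suc L + 101) + 3) ≡⟨ expand H (K + 7) ⟩
      H * 18 + 18630                  ≤⟨ +-monoˡ-≤ 18630 (≤-trans (*-monoʳ-≤ H (≤ᵇ⇒≤ 18 50 _)) quotient-≤) ⟩
      n + 6 + 18630                   ≡⟨ +-assoc n 6 18630 ⟩
      n + 18636                       ≤⟨ +-monoʳ-≤ n (≤-trans (≤ᵇ⇒≤ 18636 20000 _) n₀≤n) ⟩
      n + n                           ≡⟨ double n ⟩
      2 * n                           ∎)
      where open ≤-Reasoning

  -- Starting at u as well, WMaker makes w the only vertex joined to her first vertex.
  firstReply : 20000 ≤ n → ∀ u w → u ≢ w → WMakerReply (suc (j + 6)) (breakerMove (initial {n}) u w)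
  firstReply n₀≤n u w u≢w
    with t , t∈ , t∉ ← avoiding (u ∷ w ∷ []) (allFin n) (allFin⁺ n)
           (≤-trans (≤-trans (≤ᵇ⇒≤ 3 20000 _) n₀≤n) (≤-reflexive (sym (length-tabulate {n = n} id))))
    with A , all↭ ← extract (∈-allFin u)
    with ∈-resp-↭ all↭ t∈
  ... | here t≡u = contradiction (here t≡u) t∉
  ... | there t∈A with U , A↭ ← extract t∈A =
    u , t , (u≢t , inj₁ refl , u≁t) , inj₂ (unwins (wins-mono (≤-reflexive moves)
      (opening K≤j position sound)))
    where
    open Endgame {n} H L slack quotient-< (room n₀≤n)
    open Opening K ≤-refl ≤-refl
    u≢t : u ≢ t
    u≢t u≡t = t∉ (here (sym u≡t))
    w≢t : w ≢ t
    w≢t w≡t = t∉ (there (here (sym w≡t)))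
    u≁t : ¬ Claimed ((u , w) ∷ []) u t
    u≁t (inj₁ (here refl)) = w≢t refl
    u≁t (inj₂ (here refl)) = u≢t refl
    moves : j + 7 ≡ suc (j + 6)
    moves = +-suc j 6
    K≤j : K ≤ j
    K≤j = ≤-pred (≤-pred (≤-trans (≤ᵇ⇒≤ 995 20000 _) n₀≤n))
    cover : allFin n ↭ t ∷ u ∷ U
    cover = ↭-trans all↭ (↭-trans (prep u A↭) (swap u t ↭-refl))
    position : OnPath j ((u , t) ∷ []) ((u , w) ∷ []) t w u U
    position = record
      { walk   = edge (inj₂ (here refl))
      ; cover  = ↭-sym cover
      ; size   = suc-injective (suc-injective (trans (sym (↭-length cover)) (length-tabulate {n = n} id)))
      ; budget = ≤-reflexive (cong suc moves)
      }
    open Frame (OnPath.frame position)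
    w∈U : w ∈ U
    w∈U with ∈-resp-↭ cover (∈-allFin w)
    ... | here w≡t                = contradiction w≡t w≢t
    ... | there (here w≡u)        = contradiction (sym w≡u) u≢w
    ... | there (there w∈)        = w∈
    only : ∀ {s r} → Claimed ((u , w) ∷ []) s r → (s ≡ u × r ≡ w) ⊎ (s ≡ w × r ≡ u)
    only (inj₁ (here refl)) = inj₁ (refl , refl)
    only (inj₂ (here refl)) = inj₂ (refl , refl)
    sound : Sound ((u , w) ∷ []) t u w U
    -- WBreaker's only edge is `uw`, so the threatened vertex is his own position `w`.
    sound = is-threat (threat w∈U
      (λ s∈ r∈ c → case only c of λ where
        (inj₁ (refl , _)) → v∉U s∈
        (inj₂ (_ , refl)) → v∉U r∈)
      (λ s∈ s≢w c → case only c of λ where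
        (inj₁ (_ , s≡w)) → s≢w s≡w
        (inj₂ (u≡w , _)) → u≢w u≡w)
      (λ _ c → case only c of λ where
        (inj₁ (t≡u , _)) → u≢t (sym t≡u)
        (inj₂ (t≡w , _)) → w≢t (sym t≡w))
      (λ _ → refl))

theorem2 : ∃[ n₀ ] (∀ (n : ℕ) → n₀ ≤ n → WMakerWinsWithin (n + 6) (initial {n}))
theorem2 = 20000 , λ where
  zero       ()
  (suc zero) (s≤s ())
  (suc (suc j)) n₀≤n →
      (λ u w legal → firstReply j n₀≤n u w (proj₁ legal))
    -- WBreaker cannot be stuck at the start: the edge between the first two vertices is open to
    -- him.
    , (λ stuck → ⊥-elim (stuck zero (suc zero) ((λ ()) , inj₁ refl , λ { (inj₁ ()) ; (inj₂ ()) })))
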